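{- Let $G$ be a simple graph with $n\geq 2$ vertices and $m$ edges. Then $$|\det(G)|\leq \Big(\frac{2m}{n}\Big)^n\Big(1-\frac{2m-n}{n(n-1)}\Big)^{n-1}.$$
   Context: For a finite simple graph $G$, $\det(G)$ denotes the determinant of an adjacency matrix of $G$. -}

module Defs where

open import Data.Bool using (Bool; true; false; if_then_else_; _∧_)
open import Data.Nat as ℕ using (ℕ; zero; suc)
open import Data.Fin using (Fin; zero; suc; toℕ; punchIn)
open import Data.Integer as ℤ using (ℤ; +_)
open import Data.Rational as ℚ using (ℚ; 0ℚ; 1ℚ)
open import Relation.Binary.PropositionalEquality using (_≡_)
open import Relation.Nullary using (¬_)
open import Relation.Nullary.Decidable using (⌊_⌋)

record SimpleGraph (n : ℕ) : Set where
  field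
    adj       : Fin n → Fin n → Bool
    symmetric : ∀ i j → adj i j ≡ adj j i
    loopless  : ∀ i → adj i i ≡ false
open SimpleGraph public

sumFinℤ : (n : ℕ) → (Fin n → ℤ) → ℤ
sumFinℤ zero    f = + 0
sumFinℤ (suc n) f = f zero ℤ.+ sumFinℤ n (λ i → f (suc i))

sumFinℕ : (n : ℕ) → (Fin n → ℕ) → ℕ
sumFinℕ zero    f = 0
sumFinℕ (suc n) f = f zero ℕ.+ sumFinℕ n (λ i → f (suc i))

det : (n : ℕ) → (Fin n → Fin n → ℤ) → ℤ
det zero    A = + 1
det (suc n) A =
  sumFinℤ (suc n) (λ j →
    (ℤ.- (+ 1)) ℤ.^ toℕ j ℤ.* A zero j ℤ.* det n (λ i k → A (suc i) (punchIn j k)))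

adjMatrix : {n : ℕ} → SimpleGraph n → Fin n → Fin n → ℤ
adjMatrix G i j = if adj G i j then + 1 else + 0

detG : {n : ℕ} → SimpleGraph n → ℤ
detG {n} G = det n (adjMatrix G)

edgeCount : {n : ℕ} → SimpleGraph n → ℕ
edgeCount {n} G =
  sumFinℕ n (λ i → sumFinℕ n (λ j →
    if adj G i j ∧ ⌊ toℕ i ℕ.<? toℕ j ⌋ then 1 else 0))

-- Rational division of an integer by a natural number (only used with
-- nonzero denominators; the value at denominator 0 is irrelevant).
infixl 7 _/ℕ_
_/ℕ_ : ℤ → ℕ → ℚ
p /ℕ zero  = 0ℚ
p /ℕ suc d = p ℚ./ suc d

infixr 8 _^ℚ_
_^ℚ_ : ℚ → ℕ → ℚ
q ^ℚ zero  = 1ℚ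
q ^ℚ suc k = q ℚ.* (q ^ℚ k)

{-# OPTIONS --safe #-}
module Submission where

-- Let A be the adjacency matrix, d = 2m/n the average degree, J the all-ones
-- matrix and a = (n − d)/(n − 1), so that the bound reads d ^ n * a ^ (n − 1).
-- If d < 1, Hadamard's inequality gives det² ≤ d ^ n < 1, so the integer det
-- vanishes.  If d ≥ 1, choose κ with det (I + κJ) = 1 + nκ = a.  The entries of
-- A (I + κJ) have square sum at most n (a d)², using that the row sums have
-- square sum at least n d², and that (d − 1)(n − 1 − d) ≥ 0.  Hadamard's
-- inequality and the arithmetic-geometric mean then give (a det)² ≤ (a d) ^ (2n).

open import Defs

-- `I + κJ` scales the all-ones vector by a and fixes its orthogonal complement. In a d-regular
-- graph the all-ones vector has eigenvalue d, and the squares of the other eigenvalues sum to nd -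
-- d² = (n - 1)ad. The shift therefore makes the square sum ad((n - 1) + ad), which for ad > 0 is at
-- most n(ad)² exactly when ad ≥ 1. Since (n - 1)(ad - 1) = (d - 1)(n - 1 - d), this fails for small
-- d, and integrality has to settle that case. In an irregular graph the variance of the degrees
-- enters with a coefficient that is at most 0, so it only helps. Eigenvalues and square roots leave
-- ℚ. Hadamard's inequality is therefore proved for Gram determinants, where all comparisons are
-- between squares, and the determinant theory rests on alternating forms of the rows.

module DeterminantBound where
  open import Algebra.Bundles using (module CommutativeRing)
  open import Data.Bool using (Bool; true; false; if_then_else_; _∧_)
  open import Data.Empty using (⊥-elim)
  open import Data.Fin using (Fin; zero; suc; punchIn; toℕ)
  open import Data.Fin.Properties using (toℕ-injective)
  open import Data.Integer as ℤ using (ℤ; +_; +0; +[1+_]; -[1+_])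
  import Data.Integer.Properties as ℤ
  open import Data.Nat as ℕ using (ℕ; zero; suc)
  import Data.Nat.Properties as ℕ
  open import Data.Product using (∃; _×_; _,_; proj₁; proj₂)
  open import Data.Rational hiding (floor)
  open import Data.Rational.Properties
  open import Data.Rational.Solver using (module +-*-Solver)
  open import Data.Rational.Unnormalised as ℚᵘ using (mkℚᵘ; *≡*)
  import Data.Rational.Unnormalised.Properties as ℚᵘ
  open import Data.Sum using (inj₁; inj₂)
  open import Data.Unit using (⊤; tt)
  open import Data.Vec using (Vec; []; _∷_; map; lookup; removeAt; tabulate)
  open import Data.Vec.Properties using (map-∘; map-id; tabulate-∘; lookup-map; lookup∘tabulate)
  open import Data.Vec.Relation.Binary.Pointwise.Inductive using (Pointwise; []; _∷_)
  open import Data.Vec.Relation.Unary.All using (All; []; _∷_)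
  open import Function using (_∘_)
  open import Relation.Binary.PropositionalEquality
  open import Relation.Nullary using (Dec; yes; no)
  open import Relation.Nullary.Decidable using (⌊_⌋)
  open import Algebra.Properties.Semiring.Sum (CommutativeRing.semiring +-*-commutativeRing)
    using (sum; sum-cong-≗; sum-remove; ∑-distrib-+; ∑-comm; *-distribˡ-sum; *-distribʳ-sum; sum-replicate-zero)
  open +-*-Solver using (solve; con; _:+_; _:*_; _:-_; :-_; _:=_)
  open ≡-Reasoning

  private variable
    k m n : ℕ

  -- Determinants as alternating forms

  Row : ℕ → Set
  Row n = Fin n → ℚ

  sign : Fin n → ℚ
  sign zero    = 1ℚ
  sign (suc j) = - sign j

  -- The same first-row expansion as `det`, but on a vector of rows, so that a form can be
  -- specialised by consing fixed rows in front.
  detV : Vec (Row n) n → ℚ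
  detV []      = 1ℚ
  detV (r ∷ R) = sum λ j → (sign j * r j) * detV (map (_∘ punchIn j) R)

  -- The single law for `x + c * y` covers additivity and homogeneity. `head-cong` is a separate law
  -- because rows are functions, compared pointwise.
  record HeadLinear (F : Vec (Row n) (suc k) → ℚ) : Set where
    field
      head-cong : ∀ {x y} R → x ≗ y → F (x ∷ R) ≡ F (y ∷ R)
      linear    : ∀ c x y R → F ((λ i → x i + c * y i) ∷ R) ≡ F (x ∷ R) + c * F (y ∷ R)
  open HeadLinear

  VanishesOnRepeat : (Vec (Row n) (suc k) → ℚ) → Set
  VanishesOnRepeat {k = zero}  F = ⊤
  VanishesOnRepeat {k = suc k} F = ∀ x R → F (x ∷ x ∷ R) ≡ 0ℚ

  -- Fixing leading arguments one at a time reduces multilinearity and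
  -- alternation to conditions on the first two arguments.
  data Alternating {n : ℕ} : {k : ℕ} → (Vec (Row n) k → ℚ) → Set where
    alt₀ : ∀ {F} → Alternating {k = 0} F
    alt₊ : ∀ {k F} → HeadLinear F → VanishesOnRepeat F →
           (∀ x → Alternating {k = k} (λ R → F (x ∷ R))) → Alternating F

  alternating-cong : {F : Vec (Row n) k → ℚ} → Alternating F →
                     ∀ {R S} → Pointwise _≗_ R S → F R ≡ F S
  alternating-cong _             []       = refl
  alternating-cong (alt₊ h _ sec) {x ∷ R} (e ∷ es) =
    trans (alternating-cong (sec x) es) (head-cong h _ e)

  sum-zero : (f : Row n) → (∀ i → f i ≡ 0ℚ) → sum f ≡ 0ℚ
  sum-zero {n} f e = trans (sum-cong-≗ e) (sum-replicate-zero n)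

  sum-linear : ∀ c (f g : Row n) → sum (λ i → f i + c * g i) ≡ sum f + c * sum g
  sum-linear c f g = trans (∑-distrib-+ f (λ i → c * g i)) (cong (λ z → sum f + z) (sym (*-distribˡ-sum c g)))

  alternating-sum : (c : Fin m → ℚ) (F : Fin m → Vec (Row n) k → ℚ) →
                    (∀ j → Alternating (F j)) → Alternating (λ R → sum λ j → c j * F j R)
  alternating-sum {k = zero} c F alt = alt₀
  alternating-sum {n = n} {k = suc k} c F alt =
    alt₊ (record
      { head-cong = λ R q → sum-cong-≗ λ j → cong (c j *_) (head-cong (hl j) R q)
      ; linear = λ a x y R → begin
          sum (λ j → c j * F j ((λ i → x i + a * y i) ∷ R))
            ≡⟨ sum-cong-≗ (λ j → trans (cong (c j *_) (linear (hl j) a x y R))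
                 (solve 4 (λ c f a g → c :* (f :+ a :* g) := c :* f :+ a :* (c :* g)) refl (c j) (F j (x ∷ R)) a (F j (y ∷ R)))) ⟩
          sum (λ j → c j * F j (x ∷ R) + a * (c j * F j (y ∷ R)))
            ≡⟨ sum-linear a (λ j → c j * F j (x ∷ R)) (λ j → c j * F j (y ∷ R)) ⟩
          sum (λ j → c j * F j (x ∷ R)) + a * sum (λ j → c j * F j (y ∷ R)) ∎ })
      (vanish k F (λ j → van (alt j)))
      (λ x → alternating-sum c (λ j R → F j (x ∷ R)) (λ j → sec (alt j) x))
    where
    hl : ∀ j → HeadLinear (F j)
    hl j with alt j
    ... | alt₊ h _ _ = h
    van : ∀ {G : Vec (Row n) (suc k) → ℚ} → Alternating G → VanishesOnRepeat G
    van (alt₊ _ v _) = v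
    sec : ∀ {G : Vec (Row n) (suc k) → ℚ} → Alternating G → ∀ x → Alternating (λ R → G (x ∷ R))
    sec (alt₊ _ _ s) = s
    vanish : ∀ k (F : Fin _ → Vec (Row n) (suc k) → ℚ) → (∀ j → VanishesOnRepeat (F j)) →
             VanishesOnRepeat (λ R → sum λ j → c j * F j R)
    vanish zero    F v = tt
    vanish (suc k) F v x R = sum-zero _ λ j → trans (cong (c j *_) (v j x R)) (*-zeroʳ (c j))

  -- With `σ = punchIn j`, deleting column j from every row, this makes each minor alternating in
  -- the remaining rows.
  alternating-reindex : (σ : Fin m → Fin n) {F : Vec (Row m) k → ℚ} →
                        Alternating F → Alternating (λ R → F (map (_∘ σ) R))
  alternating-reindex σ alt₀ = alt₀
  alternating-reindex {k = suc k} σ {F} (alt₊ h v sec) =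
    alt₊ (record
      { head-cong = λ R q → head-cong h _ (λ i → q (σ i))
      ; linear = λ c x y R → linear h c (x ∘ σ) (y ∘ σ) (map (_∘ σ) R) })
      (vanish k F v) (λ x → alternating-reindex σ (sec (x ∘ σ)))
    where
    vanish : ∀ k (F : Vec (Row _) (suc k) → ℚ) → VanishesOnRepeat F →
             VanishesOnRepeat (λ R → F (map (_∘ σ) R))
    vanish zero    F v = tt
    vanish (suc k) F v x R = v (x ∘ σ) (map (_∘ σ) R)

  lift₁ : (Fin m → Fin n) → Fin (suc m) → Fin (suc n)
  lift₁ σ zero    = zero
  lift₁ σ (suc i) = suc (σ i)

  -- The terms (j , k) and (k' , j') deleting the same two columns cancel;
  -- only the terms involving column 0 are paired explicitly, the others are
  -- an instance of the same sum with one column fewer.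
  double-expansion-vanishes : ∀ n (G : (Fin n → Fin (suc (suc n))) → ℚ) →
    (∀ σ τ → σ ≗ τ → G σ ≡ G τ) → (x : Row (suc (suc n))) →
    sum (λ j → (sign j * x j) * sum (λ k → (sign k * x (punchIn j k)) * G (punchIn j ∘ punchIn k))) ≡ 0ℚ
  double-expansion-vanishes n G G-cong x = begin
    (1ℚ * x zero) * A + sum (λ j → (- sign j * x (suc j)) * (1ℚ * x zero * G (λ c → suc (punchIn j c)) + inner j))
      ≡⟨ cong (λ z → (1ℚ * x zero) * A + z) (trans (sum-cong-≗ (λ j → split j)) (∑-distrib-+ (λ j → - (1ℚ * x zero) * a j) rest)) ⟩
    (1ℚ * x zero) * A + (sum (λ j → - (1ℚ * x zero) * a j) + sum rest)
      ≡⟨ cong₂ (λ u w → (1ℚ * x zero) * A + (u + w)) (sym (*-distribˡ-sum (- (1ℚ * x zero)) a)) (rest-zero n G G-cong x) ⟩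
    (1ℚ * x zero) * A + (- (1ℚ * x zero) * A + 0ℚ)
      ≡⟨ solve 2 (λ p q → p :* q :+ (:- p :* q :+ con 0ℚ) := con 0ℚ) refl (1ℚ * x zero) A ⟩
    0ℚ ∎
    where
    a : Fin (suc n) → ℚ
    a j = (sign j * x (suc j)) * G (λ c → suc (punchIn j c))
    A = sum a
    inner : Fin (suc n) → ℚ
    inner j = sum (λ k → (- sign k * x (suc (punchIn j k))) * G (punchIn (suc j) ∘ punchIn (suc k)))
    rest : Fin (suc n) → ℚ
    rest j = (sign j * x (suc j)) * sum (λ k → (sign k * x (suc (punchIn j k))) * G (punchIn (suc j) ∘ punchIn (suc k)))
    split : ∀ j → (- sign j * x (suc j)) * (1ℚ * x zero * G (λ c → suc (punchIn j c)) + inner j)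
                  ≡ - (1ℚ * x zero) * a j + rest j
    split j = begin
      (- sign j * x (suc j)) * (1ℚ * x zero * g + inner j)
        ≡⟨ cong (λ z → (- sign j * x (suc j)) * (1ℚ * x zero * g + z)) inner≡ ⟩
      (- sign j * x (suc j)) * (1ℚ * x zero * g + - 1ℚ * sum f)
        ≡⟨ solve 5 (λ s y x₀ g t → (:- s :* y) :* (x₀ :* g :+ con (- 1ℚ) :* t) := :- x₀ :* ((s :* y) :* g) :+ (s :* y) :* t)
             refl (sign j) (x (suc j)) (1ℚ * x zero) g (sum f) ⟩
      - (1ℚ * x zero) * a j + rest j ∎
      where
      g = G (λ c → suc (punchIn j c))
      f : Fin n → ℚ
      f k = (sign k * x (suc (punchIn j k))) * G (punchIn (suc j) ∘ punchIn (suc k))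
      inner≡ : inner j ≡ - 1ℚ * sum f
      inner≡ = trans (sum-cong-≗ λ k → solve 3 (λ s y g → (:- s :* y) :* g := con (- 1ℚ) :* ((s :* y) :* g)) refl
                        (sign k) (x (suc (punchIn j k))) (G (punchIn (suc j) ∘ punchIn (suc k))))
                     (sym (*-distribˡ-sum (- 1ℚ) f))
    rest-zero : ∀ n (G : (Fin n → Fin (suc (suc n))) → ℚ) → (∀ σ τ → σ ≗ τ → G σ ≡ G τ) → (x : Row (suc (suc n))) →
      sum (λ j → (sign j * x (suc j)) * sum (λ k → (sign k * x (suc (punchIn j k))) * G (punchIn (suc j) ∘ punchIn (suc k)))) ≡ 0ℚ
    rest-zero zero    G G-cong x = sum-zero _ λ j → *-zeroʳ (sign j * x (suc j))
    rest-zero (suc n) G G-cong x = trans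
      -- Both deletion maps fix column 0 and agree only pointwise with the lifted map; this is what
      -- `G-cong` is for.
      (sum-cong-≗ λ j → cong ((sign j * x (suc j)) *_) (sum-cong-≗ λ k →
         cong ((sign k * x (suc (punchIn j k))) *_) (G-cong (punchIn (suc j) ∘ punchIn (suc k)) (lift₁ (punchIn j ∘ punchIn k)) λ { zero → refl ; (suc c) → refl })))
      (double-expansion-vanishes n (G ∘ lift₁) (λ σ τ e → G-cong (lift₁ σ) (lift₁ τ) λ { zero → refl ; (suc c) → cong suc (e c) }) (x ∘ suc))

  map⁺ : ∀ {A B : Set} {f g : A → B} {_~_ : B → B → Set} → (∀ a → f a ~ g a) →
         (as : Vec A n) → Pointwise _~_ (map f as) (map g as)
  map⁺ h []       = []
  map⁺ h (a ∷ as) = h a ∷ map⁺ h as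

  -- Once the first row x is fixed, the determinant is a combination of minors with coefficients
  -- `sign j * x j`, and the minors alternate by induction. Only equality of the first two rows
  -- needs the double expansion.
  detV-alternating : ∀ n → Alternating (detV {n})
  detV-alternating zero = alt₀
  detV-alternating (suc n) =
    alt₊ (record
      { head-cong = λ R q → sum-cong-≗ λ j → cong (λ z → (sign j * z) * detV (map (_∘ punchIn j) R)) (q j)
      ; linear = λ c x y R → begin
          sum (λ j → (sign j * (x j + c * y j)) * minor R j)
            ≡⟨ sum-cong-≗ (λ j → solve 5 (λ s x c y d → (s :* (x :+ c :* y)) :* d := (s :* x) :* d :+ c :* ((s :* y) :* d)) refl
                 (sign j) (x j) c (y j) (minor R j)) ⟩
          sum (λ j → (sign j * x j) * minor R j + c * ((sign j * y j) * minor R j))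
            ≡⟨ sum-linear c (λ j → (sign j * x j) * minor R j) (λ j → (sign j * y j) * minor R j) ⟩
          sum (λ j → (sign j * x j) * minor R j) + c * sum (λ j → (sign j * y j) * minor R j) ∎ })
      (vanish n)
      (λ x → alternating-sum (λ j → sign j * x j) (λ j R → detV (map (_∘ punchIn j) R))
               (λ j → alternating-reindex (punchIn j) (detV-alternating n)))
    where
    minor : Vec (Row (suc n)) n → Fin (suc n) → ℚ
    minor R j = detV (map (_∘ punchIn j) R)
    vanish : ∀ n → VanishesOnRepeat (detV {suc n})
    vanish zero = tt
    vanish (suc n) x R = trans
      (sum-cong-≗ λ j → cong ((sign j * x j) *_) (sum-cong-≗ λ k → cong (λ z → (sign k * x (punchIn j k)) * detV z)
         (sym (map-∘ (_∘ punchIn k) (_∘ punchIn j) R))))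
      (double-expansion-vanishes n (λ σ → detV (map (_∘ σ) R))
        (λ _ _ e → alternating-cong (detV-alternating n) (map⁺ (λ r i → cong r (e i)) R)) x)

  -- Polarization: the value at (x + y, x + y) is 0 and expands into four terms, of which the two
  -- with equal rows vanish.
  alternating-swap : {F : Vec (Row n) (suc (suc k)) → ℚ} → Alternating F →
                     ∀ x y R → F (x ∷ y ∷ R) ≡ - F (y ∷ x ∷ R)
  alternating-swap {F = F} (alt₊ h v sec) x y R with sec x | sec y | sec (λ i → x i + 1ℚ * y i)
  ... | alt₊ hx _ _ | alt₊ hy _ _ | alt₊ hs _ _ = begin
    F (x ∷ y ∷ R)
      ≡⟨ solve 4 (λ xx xy yx yy → xy := ((xx :+ con 1ℚ :* yx) :+ con 1ℚ :* (xy :+ con 1ℚ :* yy)) :- xx :- yy :- yx)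
           refl (F (x ∷ x ∷ R)) (F (x ∷ y ∷ R)) (F (y ∷ x ∷ R)) (F (y ∷ y ∷ R)) ⟩
    ((F (x ∷ x ∷ R) + 1ℚ * F (y ∷ x ∷ R)) + 1ℚ * (F (x ∷ y ∷ R) + 1ℚ * F (y ∷ y ∷ R)))
      - F (x ∷ x ∷ R) - F (y ∷ y ∷ R) - F (y ∷ x ∷ R)
      ≡⟨ cong₂ (λ a b → a - b - F (y ∷ y ∷ R) - F (y ∷ x ∷ R)) expand (v x R) ⟩
    0ℚ - 0ℚ - F (y ∷ y ∷ R) - F (y ∷ x ∷ R)
      ≡⟨ cong (λ b → 0ℚ - 0ℚ - b - F (y ∷ x ∷ R)) (v y R) ⟩
    0ℚ - 0ℚ - 0ℚ - F (y ∷ x ∷ R)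
      ≡⟨ solve 1 (λ a → con 0ℚ :- con 0ℚ :- con 0ℚ :- a := :- a) refl (F (y ∷ x ∷ R)) ⟩
    - F (y ∷ x ∷ R) ∎
    where
    s : Row _
    s i = x i + 1ℚ * y i
    expand : (F (x ∷ x ∷ R) + 1ℚ * F (y ∷ x ∷ R)) + 1ℚ * (F (x ∷ y ∷ R) + 1ℚ * F (y ∷ y ∷ R)) ≡ 0ℚ
    expand = begin
      (F (x ∷ x ∷ R) + 1ℚ * F (y ∷ x ∷ R)) + 1ℚ * (F (x ∷ y ∷ R) + 1ℚ * F (y ∷ y ∷ R))
        ≡⟨ sym (cong₂ (λ a b → a + 1ℚ * b) (linear h 1ℚ x y (x ∷ R)) (linear h 1ℚ x y (y ∷ R))) ⟩
      F (s ∷ x ∷ R) + 1ℚ * F (s ∷ y ∷ R)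
        ≡⟨ sym (linear hs 1ℚ x y R) ⟩
      F (s ∷ s ∷ R)
        ≡⟨ v s R ⟩
      0ℚ ∎

  -- Row operations and multiplicativity of the determinant

  Shear : Row n → Vec (Row n) k → Vec (Row n) k → Set
  Shear x = Pointwise (λ r s → ∃ λ c → ∀ i → s i ≡ r i + c * x i)

  -- The correction term of the second row repeats x and vanishes. Swapping x behind that row
  -- exposes the remaining rows to the same argument in the section at r; a second swap restores the
  -- sign.
  shear-invariant : {F : Vec (Row n) (suc k) → ℚ} → Alternating F →
                    ∀ x {R S} → Shear x R S → F (x ∷ S) ≡ F (x ∷ R)
  shear-invariant _ x [] = refl
  shear-invariant {F = F} alt@(alt₊ h v sec) x {r ∷ R} {s ∷ S} ((c , e) ∷ es) with sec x
  ... | alt₊ hx _ _ = begin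
    F (x ∷ s ∷ S)                     ≡⟨ head-cong hx S e ⟩
    F (x ∷ (λ i → r i + c * x i) ∷ S) ≡⟨ linear hx c r x S ⟩
    F (x ∷ r ∷ S) + c * F (x ∷ x ∷ S) ≡⟨ cong (λ z → F (x ∷ r ∷ S) + c * z) (v x S) ⟩
    F (x ∷ r ∷ S) + c * 0ℚ            ≡⟨ solve 2 (λ a c → a :+ c :* con 0ℚ := a) refl (F (x ∷ r ∷ S)) c ⟩
    F (x ∷ r ∷ S)                     ≡⟨ alternating-swap alt x r S ⟩
    - F (r ∷ x ∷ S)                   ≡⟨ cong -_ (shear-invariant (sec r) x es) ⟩
    - F (r ∷ x ∷ R)                   ≡⟨ sym (alternating-swap alt x r R) ⟩
    F (x ∷ r ∷ R) ∎

  -- Row j passes j rows by adjacent swaps, which yields the same sign as in the Laplace expansion.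
  alternating-move-to-front : {F : Vec (Row n) (suc k) → ℚ} → Alternating F →
    ∀ (C : Vec (Row n) (suc k)) j → F (lookup C j ∷ removeAt C j) ≡ sign j * F C
  alternating-move-to-front alt (x ∷ C) zero = sym (*-identityˡ _)
  alternating-move-to-front {F = F} alt@(alt₊ _ _ sec) (x ∷ C@(_ ∷ _)) (suc j) = begin
    F (lookup C j ∷ x ∷ removeAt C j)   ≡⟨ alternating-swap alt (lookup C j) x (removeAt C j) ⟩
    - F (x ∷ lookup C j ∷ removeAt C j) ≡⟨ cong -_ (alternating-move-to-front (sec x) C j) ⟩
    - (sign j * F (x ∷ C))              ≡⟨ neg-distribˡ-* (sign j) (F (x ∷ C)) ⟩
    - sign j * F (x ∷ C) ∎

  -- The row vector a times the matrix C. Thus `map (combine C) K` is the matrix product K C.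
  combine : Vec (Row n) k → Row k → Row n
  combine C a i = sum λ j → a j * lookup C j i

  head-combine : {F : Vec (Row n) (suc k) → ℚ} → HeadLinear F → ∀ (a : Row m) C R →
                 F (combine C a ∷ R) ≡ sum λ j → a j * F (lookup C j ∷ R)
  head-combine {F = F} h a [] R = begin
    F ((λ _ → 0ℚ) ∷ R)                   ≡⟨ head-cong h R (λ _ → refl) ⟩
    -- Writing the zero row as 0 - 0 turns linearity into F = F - F.
    F ((λ _ → 0ℚ + - 1ℚ * 0ℚ) ∷ R)       ≡⟨ linear h (- 1ℚ) (λ _ → 0ℚ) (λ _ → 0ℚ) R ⟩
    F ((λ _ → 0ℚ) ∷ R) + - 1ℚ * F ((λ _ → 0ℚ) ∷ R)
      ≡⟨ solve 1 (λ z → z :+ con (- 1ℚ) :* z := con 0ℚ) refl (F ((λ _ → 0ℚ) ∷ R)) ⟩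
    0ℚ ∎
  head-combine {F = F} h a (x ∷ C) R = begin
    F (combine (x ∷ C) a ∷ R)
      ≡⟨ head-cong h R (λ i → +-comm (a zero * x i) (combine C (a ∘ suc) i)) ⟩
    F ((λ i → combine C (a ∘ suc) i + a zero * x i) ∷ R)
      ≡⟨ linear h (a zero) (combine C (a ∘ suc)) x R ⟩
    F (combine C (a ∘ suc) ∷ R) + a zero * F (x ∷ R)
      ≡⟨ cong (_+ a zero * F (x ∷ R)) (head-combine h (a ∘ suc) C R) ⟩
    sum (λ j → a (suc j) * F (lookup C j ∷ R)) + a zero * F (x ∷ R)
      ≡⟨ +-comm (sum (λ j → a (suc j) * F (lookup C j ∷ R))) (a zero * F (x ∷ R)) ⟩
    a zero * F (x ∷ R) + sum (λ j → a (suc j) * F (lookup C j ∷ R)) ∎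

  lookup-removeAt : ∀ {A : Set} (C : Vec A (suc k)) j i → lookup (removeAt C j) i ≡ lookup C (punchIn j i)
  lookup-removeAt (x ∷ C)         zero    i       = refl
  lookup-removeAt (x ∷ y ∷ C)     (suc j) zero    = refl
  lookup-removeAt (x ∷ C@(_ ∷ _)) (suc j) (suc i) = lookup-removeAt C j i

  combine-removeAt : ∀ (C : Vec (Row n) (suc k)) a j i →
    combine C a i ≡ combine (removeAt C j) (a ∘ punchIn j) i + a j * lookup C j i
  combine-removeAt C a j i = begin
    sum t
      ≡⟨ sum-remove {i = j} t ⟩
    a j * lookup C j i + sum (t ∘ punchIn j)
      ≡⟨ +-comm (a j * lookup C j i) (sum (t ∘ punchIn j)) ⟩
    sum (t ∘ punchIn j) + a j * lookup C j i
      ≡⟨ cong (_+ a j * lookup C j i) (sum-cong-≗ λ l → cong (λ z → a (punchIn j l) * z i) (sym (lookup-removeAt C j l))) ⟩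
    combine (removeAt C j) (a ∘ punchIn j) i + a j * lookup C j i ∎
    where
    t : Row _
    t l = a l * lookup C l i

  -- Uniqueness of the determinant: expand the first row of K, then use shears
  -- by C j to remove column j from the remaining rows of K.
  alternating-combine : {F : Vec (Row n) k → ℚ} → Alternating F →
    ∀ (K : Vec (Row k) k) C → F (map (combine C) K) ≡ detV K * F C
  alternating-combine alt₀ [] [] = sym (*-identityˡ _)
  alternating-combine {k = suc k} {F = F} alt@(alt₊ h v sec) (a ∷ K) C = begin
    F (combine C a ∷ map (combine C) K)
      ≡⟨ head-combine h a C (map (combine C) K) ⟩
    sum (λ j → a j * F (lookup C j ∷ map (combine C) K))
      ≡⟨ sum-cong-≗ term ⟩
    sum (λ j → ((sign j * a j) * detV (map (_∘ punchIn j) K)) * F C)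
      ≡⟨ sym (*-distribʳ-sum (F C) (λ j → (sign j * a j) * detV (map (_∘ punchIn j) K))) ⟩
    detV (a ∷ K) * F C ∎
    where
    term : ∀ j → a j * F (lookup C j ∷ map (combine C) K)
                 ≡ ((sign j * a j) * detV (map (_∘ punchIn j) K)) * F C
    term j = begin
      a j * F (lookup C j ∷ map (combine C) K)
        ≡⟨ cong (a j *_) (shear-invariant alt (lookup C j)
             (map⁺ (λ b → b j , combine-removeAt C b j) K)) ⟩
      a j * F (lookup C j ∷ map (λ b → combine (removeAt C j) (b ∘ punchIn j)) K)
        ≡⟨ cong (λ z → a j * F (lookup C j ∷ z)) (map-∘ (combine (removeAt C j)) (_∘ punchIn j) K) ⟩
      a j * F (lookup C j ∷ map (combine (removeAt C j)) (map (_∘ punchIn j) K))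
        ≡⟨ cong (a j *_) (alternating-combine (sec (lookup C j)) (map (_∘ punchIn j) K) (removeAt C j)) ⟩
      a j * (d * F (lookup C j ∷ removeAt C j))
        ≡⟨ cong (λ z → a j * (d * z)) (alternating-move-to-front alt C j) ⟩
      a j * (d * (sign j * F C))
        ≡⟨ solve 4 (λ a d s f → a :* (d :* (s :* f)) := ((s :* a) :* d) :* f) refl (a j) d (sign j) (F C) ⟩
      ((sign j * a j) * d) * F C ∎
      where d = detV (map (_∘ punchIn j) K)

  detV-combine : (K C : Vec (Row n) n) → detV (map (combine C) K) ≡ detV K * detV C
  detV-combine {n} = alternating-combine (detV-alternating n)

  detV-cong : {R S : Vec (Row n) n} → Pointwise _≗_ R S → detV R ≡ detV S
  detV-cong {n} = alternating-cong (detV-alternating n)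

  -- Elimination of the first column

  all-punchIn : ∀ (R : Vec (Row (suc (suc n))) k) j → All (λ r → r zero ≡ 0ℚ) R →
                All (λ r → r zero ≡ 0ℚ) (map (_∘ punchIn (suc j)) R)
  all-punchIn []      j []       = []
  all-punchIn (r ∷ R) j (e ∷ es) = e ∷ all-punchIn R j es

  -- A minor that keeps column 0 has zero first column throughout, since row r is gone; by induction
  -- it is its own corner entry, 0, times a smaller determinant. So only the minor deleting column 0
  -- survives.
  detV-zero-below : ∀ (r : Row (suc n)) (R : Vec (Row (suc n)) n) → All (λ s → s zero ≡ 0ℚ) R →
                    detV (r ∷ R) ≡ r zero * detV (map (_∘ suc) R)
  detV-zero-below {n} r R zs = begin
    (1ℚ * r zero) * d + sum t ≡⟨ cong (λ z → (1ℚ * r zero) * d + z) (sum-zero t (vanish n R zs (λ j → - sign j * r (suc j)))) ⟩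
    (1ℚ * r zero) * d + 0ℚ    ≡⟨ solve 2 (λ x d → (con 1ℚ :* x) :* d :+ con 0ℚ := x :* d) refl (r zero) d ⟩
    r zero * d ∎
    where
    d = detV (map (_∘ suc) R)
    t : Row _
    t j = (- sign j * r (suc j)) * detV (map (_∘ punchIn (suc j)) R)
    vanish : ∀ n (R : Vec (Row (suc n)) n) → All (λ s → s zero ≡ 0ℚ) R → ∀ (c : Row n) (j : Fin n) →
             c j * detV (map (_∘ punchIn (suc j)) R) ≡ 0ℚ
    vanish (suc n) (s ∷ S) (z ∷ zs) c j = begin
      c j * detV ((s ∘ punchIn (suc j)) ∷ map (_∘ punchIn (suc j)) S)
        ≡⟨ cong (c j *_) (detV-zero-below (s ∘ punchIn (suc j)) _ (all-punchIn S j zs)) ⟩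
      c j * (s zero * e)
        ≡⟨ cong (λ y → c j * (y * e)) z ⟩
      c j * (0ℚ * e)
        ≡⟨ solve 2 (λ c e → c :* (con 0ℚ :* e) := con 0ℚ) refl (c j) e ⟩
      0ℚ ∎
      where e = detV (map (_∘ suc) (map (_∘ punchIn (suc j)) S))

  -- Here q is the inverse of the pivot.
  schur-row : ℚ → Row (suc n) → Row (suc n) → Row n
  schur-row q r s j = s (suc j) + (- (s zero * q)) * r (suc j)

  -- Shears by the top row clear the first column, and what is left beside it is the Schur
  -- complement.
  detV-schur : ∀ q (r : Row (suc n)) R → r zero * q ≡ 1ℚ →
               detV (r ∷ R) ≡ r zero * detV (map (schur-row q r) R)
  detV-schur {n} q r R pq = begin
    detV (r ∷ R)
      ≡⟨ sym (shear-invariant (detV-alternating (suc n)) r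
           (subst (λ z → Shear r z (map clear R)) (map-id R) (map⁺ (λ s → - (s zero * q) , λ i → refl) R))) ⟩
    detV (r ∷ map clear R)
      ≡⟨ detV-zero-below r (map clear R) (cleared R) ⟩
    r zero * detV (map (_∘ suc) (map clear R))
      ≡⟨ cong (λ z → r zero * detV z) (sym (map-∘ (_∘ suc) clear R)) ⟩
    r zero * detV (map (schur-row q r) R) ∎
    where
    clear : Row (suc n) → Row (suc n)
    clear s i = s i + (- (s zero * q)) * r i
    cleared : ∀ {k} (R : Vec _ k) → All (λ s → s zero ≡ 0ℚ) (map clear R)
    cleared []      = []
    cleared (s ∷ R) = (begin
      s zero + (- (s zero * q)) * r zero
        ≡⟨ solve 3 (λ s p q → s :+ (:- (s :* q)) :* p := s :- s :* (p :* q)) refl (s zero) (r zero) q ⟩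
      s zero - s zero * (r zero * q)
        ≡⟨ cong (λ z → s zero - s zero * z) pq ⟩
      s zero - s zero * 1ℚ
        ≡⟨ solve 1 (λ s → s :- s :* con 1ℚ := con 0ℚ) refl (s zero) ⟩
      0ℚ ∎) ∷ cleared R

  -- Gram determinants

  infixl 8 _0≤+_
  infixl 9 _0≤*_

  _0≤+_ : ∀ {p q} → 0ℚ ≤ p → 0ℚ ≤ q → 0ℚ ≤ p + q
  _0≤+_ = +-mono-≤

  _0≤*_ : ∀ {p q} → 0ℚ ≤ p → 0ℚ ≤ q → 0ℚ ≤ p * q
  _0≤*_ {p} {q} hp hq =
    nonNegative⁻¹ (p * q) {{nonNeg*nonNeg⇒nonNeg p {{nonNegative hp}} q {{nonNegative hq}}}}

  0≤square : ∀ p → 0ℚ ≤ p * p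
  0≤square p with ≤-total 0ℚ p
  ... | inj₁ h = h 0≤* h
  ... | inj₂ h = nonNegative⁻¹ (p * p) {{nonPos*nonPos⇒nonPos p {{nonPositive h}} p {{nonPositive h}}}}

  0≤^ : ∀ {p} k → 0ℚ ≤ p → 0ℚ ≤ p ^ℚ k
  0≤^ zero    h = nonNegative⁻¹ 1ℚ
  0≤^ (suc k) h = h 0≤* 0≤^ k h

  ≤-from-gap : ∀ {p q} d → 0ℚ ≤ d → q ≡ p + d → p ≤ q
  ≤-from-gap {p} {q} d h e = subst₂ _≤_ (+-identityʳ p) (sym e) (+-monoʳ-≤ p h)

  gap : ∀ {p q} → p ≤ q → 0ℚ ≤ q - p
  gap {p} {q} h = subst (_≤ q - p) (+-inverseʳ p) (+-monoˡ-≤ (- p) h)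

  0≤sum : (f : Row n) → (∀ i → 0ℚ ≤ f i) → 0ℚ ≤ sum f
  0≤sum {zero}  f h = ≤-refl
  0≤sum {suc n} f h = h zero 0≤+ 0≤sum (f ∘ suc) (h ∘ suc)

  sum-of-squares-zero : (x : Row n) → sum (λ i → x i * x i) ≡ 0ℚ → ∀ i → x i ≡ 0ℚ
  sum-of-squares-zero {suc n} x e = λ where
      zero    → x²≡0⇒x≡0 (≤-antisym (≤-from-gap s s≥0 (sym e)) (0≤square (x zero)))
      (suc i) → sum-of-squares-zero (x ∘ suc)
        (≤-antisym (≤-from-gap (x zero * x zero) (0≤square (x zero)) (trans (sym e) (+-comm (x zero * x zero) s))) s≥0) i
    where
    s = sum (λ i → x (suc i) * x (suc i))
    s≥0 : 0ℚ ≤ s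
    s≥0 = 0≤sum _ (λ i → 0≤square (x (suc i)))
    x²≡0⇒x≡0 : ∀ {p} → p * p ≡ 0ℚ → p ≡ 0ℚ
    x²≡0⇒x≡0 {p} e with p ≟ 0ℚ
    ... | yes p≡0 = p≡0
    ... | no  p≢0 = begin
      p                ≡⟨ sym (*-identityʳ p) ⟩
      p * 1ℚ           ≡⟨ cong (p *_) (sym (*-inverseʳ p)) ⟩
      p * (p * 1/ p)   ≡⟨ sym (*-assoc p p (1/ p)) ⟩
      p * p * 1/ p     ≡⟨ cong (_* 1/ p) e ⟩
      0ℚ * 1/ p        ≡⟨ *-zeroˡ (1/ p) ⟩
      0ℚ ∎
      where instance _ = ≢-nonZero p≢0

  inverse : ∀ p → 0ℚ < p → ∃ λ q → 0ℚ < q × p * q ≡ 1ℚ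
  inverse p h = 1/ p , positive⁻¹ (1/ p) {{1/pos⇒pos p}} , *-inverseʳ p
    where
    instance
      _ = positive h
      _ = pos⇒nonZero p

  fromℕ : ℕ → ℚ
  fromℕ zero    = 0ℚ
  fromℕ (suc n) = 1ℚ + fromℕ n

  0≤fromℕ : ∀ n → 0ℚ ≤ fromℕ n
  0≤fromℕ zero    = ≤-refl
  0≤fromℕ (suc n) = nonNegative⁻¹ 1ℚ 0≤+ 0≤fromℕ n

  0<fromℕ : ∀ n → 0ℚ < fromℕ (suc n)
  0<fromℕ n = <-≤-trans (positive⁻¹ 1ℚ) (≤-from-gap (fromℕ n) (0≤fromℕ n) refl)

  -- The number (k + 1)u - ky together with k copies of y has mean u. This form avoids roots and
  -- puts no sign condition on the first factor.
  am-gm : ∀ k {u y} → 0ℚ ≤ u → 0ℚ ≤ y →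
          (fromℕ (suc k) * u - fromℕ k * y) * y ^ℚ k ≤ u ^ℚ suc k
  am-gm k {u} {y} hu hy = ≤-from-gap (δ k) (0≤δ k)
    (solve 2 (λ a b → a := b :+ (a :- b)) refl (u ^ℚ suc k) ((fromℕ (suc k) * u - fromℕ k * y) * y ^ℚ k))
    where
    δ : ℕ → ℚ
    δ k = u ^ℚ suc k - (fromℕ (suc k) * u - fromℕ k * y) * y ^ℚ k
    0≤δ : ∀ k → 0ℚ ≤ δ k
    -- δ (k + 1) = u δ k + (k + 1) yᵏ (u − y)²
    0≤δ zero = ≤-reflexive (solve 2 (λ u y → con 0ℚ := u :* con 1ℚ :- ((con 1ℚ :+ con 0ℚ) :* u :- con 0ℚ :* y) :* con 1ℚ) refl u y)
    0≤δ (suc k) = subst (0ℚ ≤_)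
      (solve 5 (λ u y v w c → u :* (u :* v :- ((con 1ℚ :+ c) :* u :- c :* y) :* w) :+ (con 1ℚ :+ c) :* w :* ((u :- y) :* (u :- y))
         := u :* (u :* v) :- ((con 1ℚ :+ (con 1ℚ :+ c)) :* u :- (con 1ℚ :+ c) :* y) :* (y :* w))
         refl u y (u ^ℚ k) (y ^ℚ k) (fromℕ k))
      (hu 0≤* 0≤δ k 0≤+ 0≤fromℕ (suc k) 0≤* 0≤^ k hy 0≤* 0≤square (u - y))

  -- Gram matrices and orthogonal projection

  dot : Row n → Row n → ℚ
  dot x y = sum λ i → x i * y i

  dot-comm : (x y : Row n) → dot x y ≡ dot y x
  dot-comm x y = sum-cong-≗ λ i → *-comm (x i) (y i)

  dot-linearˡ : ∀ c (x y z : Row n) → dot (λ i → x i + c * y i) z ≡ dot x z + c * dot y z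
  dot-linearˡ c x y z = trans
    (sum-cong-≗ λ i → solve 4 (λ x c y z → (x :+ c :* y) :* z := x :* z :+ c :* (y :* z)) refl (x i) c (y i) (z i))
    (sum-linear c (λ i → x i * z i) (λ i → y i * z i))

  dot-linearʳ : ∀ c (x y z : Row n) → dot z (λ i → x i + c * y i) ≡ dot z x + c * dot z y
  dot-linearʳ c x y z = trans (dot-comm z _)
    (trans (dot-linearˡ c x y z) (cong₂ (λ a b → a + c * b) (dot-comm x z) (dot-comm y z)))

  gram : Vec (Row m) n → Vec (Row n) n
  gram v = map (λ u j → dot u (lookup v j)) v

  -- The trace of the Gram matrix, that is, the squared Frobenius norm.
  energy : Vec (Row m) n → ℚ
  energy []      = 0ℚ
  energy (x ∷ v) = dot x x + energy v

  0≤energy : (v : Vec (Row m) n) → 0ℚ ≤ energy v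
  0≤energy []      = ≤-refl
  0≤energy (x ∷ v) = 0≤sum _ (λ i → 0≤square (x i)) 0≤+ 0≤energy v

  module Projection (x : Row m) (q : ℚ) (0≤q : 0ℚ ≤ q) (x²q≡1 : dot x x * q ≡ 1ℚ) where

    -- The orthogonal projection onto the complement of x; q is the inverse of the squared norm of
    -- x.
    project : Row m → Row m
    project u i = u i + (- (dot u x * q)) * x i

    -- The left side is an entry of the Schur complement. The projection of u is orthogonal to x, so
    -- projecting z as well changes nothing.
    dot-project : ∀ u z → dot u z + (- (dot u x * q)) * dot x z ≡ dot (project u) (project z)
    dot-project u z = sym (begin
      dot (project u) (project z)
        ≡⟨ dot-linearʳ (- (dot z x * q)) z x (project u) ⟩
      dot (project u) z + (- (dot z x * q)) * dot (project u) x
        ≡⟨ cong₂ (λ a b → a + (- (dot z x * q)) * b)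
             (dot-linearˡ (- (dot u x * q)) u x z) (dot-linearˡ (- (dot u x * q)) u x x) ⟩
      (dot u z + (- (dot u x * q)) * dot x z) + (- (dot z x * q)) * (dot u x + (- (dot u x * q)) * dot x x)
        ≡⟨ solve 6 (λ uz ux xz zx xx q →
             (uz :+ (:- (ux :* q)) :* xz) :+ (:- (zx :* q)) :* (ux :+ (:- (ux :* q)) :* xx)
             := (uz :+ (:- (ux :* q)) :* xz) :+ (:- (zx :* q)) :* (ux :- ux :* (xx :* q)))
             refl (dot u z) (dot u x) (dot x z) (dot z x) (dot x x) q ⟩
      (dot u z + (- (dot u x * q)) * dot x z) + (- (dot z x * q)) * (dot u x - dot u x * (dot x x * q))
        ≡⟨ cong (λ c → (dot u z + (- (dot u x * q)) * dot x z) + (- (dot z x * q)) * (dot u x - dot u x * c)) x²q≡1 ⟩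
      (dot u z + (- (dot u x * q)) * dot x z) + (- (dot z x * q)) * (dot u x - dot u x * 1ℚ)
        ≡⟨ solve 3 (λ a b c → a :+ b :* (c :- c :* con 1ℚ) := a) refl
             (dot u z + (- (dot u x * q)) * dot x z) (- (dot z x * q)) (dot u x) ⟩
      dot u z + (- (dot u x * q)) * dot x z ∎)

    -- Pythagoras: each vector u loses exactly `q * (dot u x * dot u x)`.
    energy-project : (v : Vec (Row m) n) → energy (map project v) ≤ energy v
    energy-project []      = ≤-refl
    energy-project (u ∷ v) = +-mono-≤
      (≤-from-gap {dot (project u) (project u)} (q * (dot u x * dot u x)) (0≤q 0≤* 0≤square (dot u x)) (begin
        dot u u
          ≡⟨ solve 3 (λ uu ux q → uu := (uu :+ (:- (ux :* q)) :* ux) :+ q :* (ux :* ux)) refl (dot u u) (dot u x) q ⟩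
        (dot u u + (- (dot u x * q)) * dot u x) + q * (dot u x * dot u x)
          ≡⟨ cong (λ z → (dot u u + (- (dot u x * q)) * z) + q * (dot u x * dot u x)) (dot-comm u x) ⟩
        (dot u u + (- (dot u x * q)) * dot x u) + q * (dot u x * dot u x)
          ≡⟨ cong (_+ q * (dot u x * dot u x)) (dot-project u u) ⟩
        dot (project u) (project u) + q * (dot u x * dot u x) ∎))
      (energy-project v)

    -- One Gram-Schmidt step: the Schur complement of a Gram matrix is the Gram matrix of the
    -- projected vectors.
    detV-gram : (v : Vec (Row m) n) → detV (gram (x ∷ v)) ≡ dot x x * detV (gram (map project v))
    detV-gram v = begin
      detV (gram (x ∷ v))
        ≡⟨ detV-schur q x̂ (map product v) x²q≡1 ⟩
      dot x x * detV (map (schur-row q x̂) (map product v))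
        ≡⟨ cong (λ z → dot x x * detV z) (sym (map-∘ (schur-row q x̂) product v)) ⟩
      dot x x * detV (map (λ u j → dot u (lookup v j) + (- (dot u x * q)) * dot x (lookup v j)) v)
        ≡⟨ cong (dot x x *_) (detV-cong (map⁺ (λ u j → trans (dot-project u (lookup v j))
             (cong (dot (project u)) (sym (lookup-map j project v)))) v)) ⟩
      dot x x * detV (map (λ u j → dot (project u) (lookup (map project v) j)) v)
        ≡⟨ cong (λ z → dot x x * detV z) (map-∘ (λ u j → dot u (lookup (map project v) j)) project v) ⟩
      dot x x * detV (gram (map project v)) ∎
      where
      product : Row m → Row _
      product u j = dot u (lookup (x ∷ v) j)
      x̂ : Row _
      x̂ = product x

  detV-gram-degenerate : ∀ (x : Row m) (v : Vec (Row m) n) → dot x x ≡ 0ℚ → detV (gram (x ∷ v)) ≡ 0ℚ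
  detV-gram-degenerate x v e = sum-zero _ λ j → trans
    (cong (λ z → (sign j * z) * minor j) (sum-zero _ λ i →
      trans (cong (_* lookup (x ∷ v) j i) (sum-of-squares-zero x e i)) (*-zeroˡ (lookup (x ∷ v) j i))))
    (solve 2 (λ s d → (s :* con 0ℚ) :* d := con 0ℚ) refl (sign j) (minor j))
    where
    minor : Fin _ → ℚ
    minor j = detV (map (_∘ punchIn j) (map (λ u j → dot u (lookup (x ∷ v) j)) v))

  -- The implication serves n = 0, where no division is possible and only t = 0 is a multiple of
  -- `fromℕ n`.
  mean : ∀ n t → 0ℚ ≤ t → (n ≡ 0 → t ≡ 0ℚ) → ∃ λ y → 0ℚ ≤ y × t ≡ fromℕ n * y
  mean zero    t ht h = 0ℚ , ≤-refl , h refl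
  mean (suc n) t ht h with inverse (fromℕ (suc n)) (0<fromℕ n)
  ... | q , 0<q , e = t * q , ht 0≤* <⇒≤ 0<q , sym (begin
    fromℕ (suc n) * (t * q) ≡⟨ solve 3 (λ a t q → a :* (t :* q) := t :* (a :* q)) refl (fromℕ (suc n)) t q ⟩
    t * (fromℕ (suc n) * q) ≡⟨ cong (t *_) e ⟩
    t * 1ℚ                  ≡⟨ *-identityʳ t ⟩
    t ∎)

  -- Hadamard's inequality combined with the arithmetic-geometric mean: the
  -- pivot and the energy of the projected vectors add up to at most energy v.
  detV-gram-bound : ∀ (v : Vec (Row m) n) u → 0ℚ ≤ u → energy v ≤ fromℕ n * u → detV (gram v) ≤ u ^ℚ n
  detV-gram-bound []      u hu h = ≤-refl
  detV-gram-bound {n = suc n} (x ∷ v) u hu h with dot x x ≟ 0ℚ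
  ... | yes e = subst (_≤ u ^ℚ suc n) (sym (detV-gram-degenerate x v e)) (0≤^ (suc n) hu)
  ... | no  e with inverse (dot x x) (≤∧≢⇒< (0≤sum _ (λ i → 0≤square (x i))) (e ∘ sym))
    where
    ≤∧≢⇒< : ∀ {p q} → p ≤ q → p ≢ q → p < q
    ≤∧≢⇒< {p} {q} p≤q p≢q = ≰⇒> λ q≤p → p≢q (≤-antisym p≤q q≤p)
  -- y averages the energy before projection. Projection only lowers the energy, so the induction
  -- hypothesis applies with y, while the pivot is compared with energy v itself.
  ...   | q , 0<q , pq with mean n (energy v) (0≤energy v) (λ { refl → energy-[] v })
    where
    energy-[] : (v : Vec (Row m) 0) → energy v ≡ 0ℚ
    energy-[] [] = refl
  ...     | y , 0≤y , ev = bound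
    where
    open Projection x q (<⇒≤ 0<q) pq
    IH : detV (gram (map project v)) ≤ y ^ℚ n
    IH = detV-gram-bound (map project v) y 0≤y (≤-trans (energy-project v) (≤-reflexive ev))
    pivot : dot x x ≤ fromℕ (suc n) * u - fromℕ n * y
    pivot = ≤-from-gap (fromℕ (suc n) * u - energy (x ∷ v)) (gap h) (begin
      fromℕ (suc n) * u - fromℕ n * y
        ≡⟨ cong (λ e → fromℕ (suc n) * u - e) (sym ev) ⟩
      fromℕ (suc n) * u - energy v
        ≡⟨ solve 3 (λ a e p → a :- e := p :+ (a :- (p :+ e))) refl (fromℕ (suc n) * u) (energy v) (dot x x) ⟩
      dot x x + (fromℕ (suc n) * u - energy (x ∷ v)) ∎)
    instance
      _ = nonNegative (0≤sum (λ i → x i * x i) (λ i → 0≤square (x i)))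
      _ = nonNegative (0≤^ n 0≤y)
    bound : detV (gram (x ∷ v)) ≤ u ^ℚ suc n
    bound = ≤-trans (≤-reflexive (detV-gram v))
      (≤-trans (*-monoˡ-≤-nonNeg (dot x x) IH)
      (≤-trans (*-monoʳ-≤-nonNeg (y ^ℚ n) pivot)
      (am-gm n hu 0≤y)))

  -- Shifting a symmetric matrix by a multiple of its row sums

  Symmetric : (Fin n → Fin n → ℚ) → Set
  Symmetric A = ∀ i j → A i j ≡ A j i

  -- Structural recursion makes the block without row and column 0 again `δ` by computation, as the
  -- elimination in `I+κJ` uses.
  δ : Fin n → Fin n → ℚ
  δ zero    zero    = 1ℚ
  δ zero    (suc j) = 0ℚ
  δ (suc i) zero    = 0ℚ
  δ (suc i) (suc j) = δ i j

  δ-symmetric : Symmetric (δ {n})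
  δ-symmetric zero    zero    = refl
  δ-symmetric zero    (suc j) = refl
  δ-symmetric (suc i) zero    = refl
  δ-symmetric (suc i) (suc j) = δ-symmetric i j

  sum-δ : ∀ (f : Row n) i → sum (λ j → f j * δ j i) ≡ f i
  sum-δ f zero = begin
    f zero * 1ℚ + sum (λ j → f (suc j) * 0ℚ)
      ≡⟨ cong₂ _+_ (*-identityʳ (f zero)) (sum-zero _ λ j → *-zeroʳ (f (suc j))) ⟩
    f zero + 0ℚ ≡⟨ +-identityʳ (f zero) ⟩
    f zero ∎
  sum-δ f (suc i) = begin
    f zero * 0ℚ + sum (λ j → f (suc j) * δ j i) ≡⟨ cong₂ _+_ (*-zeroʳ (f zero)) (sum-δ (f ∘ suc) i) ⟩
    0ℚ + f (suc i)                              ≡⟨ +-identityˡ (f (suc i)) ⟩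
    f (suc i) ∎

  sum-const : ∀ n c → sum {n} (λ _ → c) ≡ fromℕ n * c
  sum-const zero    c = sym (*-zeroˡ c)
  sum-const (suc n) c = trans (cong (λ z → c + z) (sum-const n c))
    (solve 2 (λ c m → c :+ m :* c := (con 1ℚ :+ m) :* c) refl c (fromℕ n))

  shiftedδ : ℚ → Fin n → Row n
  shiftedδ κ i j = δ i j + κ

  I+κJ : ∀ n → ℚ → Vec (Row n) n
  I+κJ n κ = tabulate (shiftedδ κ)

  tabulate-≗ : ∀ {R S : Fin k → Row n} → (∀ i → R i ≗ S i) → Pointwise _≗_ (tabulate R) (tabulate S)
  tabulate-≗ {zero}  e = []
  tabulate-≗ {suc k} e = e zero ∷ tabulate-≗ (λ i → e (suc i))

  -- Eliminating the first row of I + κJ leaves I + κ′J with κ′ = κ / (1 + κ).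
  detV-I+κJ : ∀ n κ → 0ℚ < 1ℚ + fromℕ n * κ → detV (I+κJ n κ) ≡ 1ℚ + fromℕ n * κ
  detV-I+κJ zero    κ h = solve 1 (λ κ → con 1ℚ := con 1ℚ :+ con 0ℚ :* κ) refl κ
  detV-I+κJ (suc n) κ h with inverse (1ℚ + κ) 0<1+κ
    where
    -- For κ ≤ 0 the pivot exceeds the positive quantity 1 + (n + 1)κ by -nκ ≥ 0.
    0<1+κ : 0ℚ < 1ℚ + κ
    0<1+κ with ≤-total 0ℚ κ
    ... | inj₁ 0≤κ = <-≤-trans (positive⁻¹ 1ℚ) (≤-from-gap κ 0≤κ refl)
    ... | inj₂ κ≤0 = <-≤-trans h (≤-from-gap (fromℕ n * (0ℚ - κ)) (0≤fromℕ n 0≤* gap κ≤0)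
      (solve 2 (λ κ m → con 1ℚ :+ κ := con 1ℚ :+ (con 1ℚ :+ m) :* κ :+ m :* (con 0ℚ :- κ)) refl κ (fromℕ n)))
  ... | q , 0<q , e = begin
    detV (I+κJ (suc n) κ)
      ≡⟨ detV-schur q top (tabulate rest) e ⟩
    (1ℚ + κ) * detV (map (schur-row q top) (tabulate rest))
      ≡⟨ cong (λ z → (1ℚ + κ) * detV z) (sym (tabulate-∘ (schur-row q top) rest)) ⟩
    (1ℚ + κ) * detV (tabulate (schur-row q top ∘ rest))
      ≡⟨ cong ((1ℚ + κ) *_) (detV-cong (tabulate-≗ {R = schur-row q top ∘ rest} {S = shiftedδ (κ * q)} entry)) ⟩
    (1ℚ + κ) * detV (I+κJ n (κ * q))
      ≡⟨ cong ((1ℚ + κ) *_) (detV-I+κJ n (κ * q) positive′) ⟩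
    (1ℚ + κ) * (1ℚ + fromℕ n * (κ * q))
      ≡⟨ solve 3 (λ κ q m → (con 1ℚ :+ κ) :* (con 1ℚ :+ m :* (κ :* q))
           := con 1ℚ :+ κ :+ m :* κ :* ((con 1ℚ :+ κ) :* q)) refl κ q (fromℕ n) ⟩
    1ℚ + κ + fromℕ n * κ * ((1ℚ + κ) * q)
      ≡⟨ cong (λ z → 1ℚ + κ + fromℕ n * κ * z) e ⟩
    1ℚ + κ + fromℕ n * κ * 1ℚ
      ≡⟨ solve 2 (λ κ m → con 1ℚ :+ κ :+ m :* κ :* con 1ℚ := con 1ℚ :+ (con 1ℚ :+ m) :* κ) refl κ (fromℕ n) ⟩
    1ℚ + fromℕ (suc n) * κ ∎
    where
    top : Row (suc n)
    top = shiftedδ κ zero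
    rest : Fin n → Row (suc n)
    rest i = shiftedδ κ (suc i)
    entry : ∀ i j → δ i j + κ + (- ((0ℚ + κ) * q)) * (0ℚ + κ) ≡ δ i j + κ * q
    entry i j = begin
      δ i j + κ + (- ((0ℚ + κ) * q)) * (0ℚ + κ)
        ≡⟨ solve 3 (λ d κ q → d :+ κ :+ (:- ((con 0ℚ :+ κ) :* q)) :* (con 0ℚ :+ κ)
             := d :+ κ :* q :+ κ :* (con 1ℚ :- (con 1ℚ :+ κ) :* q)) refl (δ i j) κ q ⟩
      δ i j + κ * q + κ * (1ℚ - (1ℚ + κ) * q)
        ≡⟨ cong (λ z → δ i j + κ * q + κ * (1ℚ - z)) e ⟩
      δ i j + κ * q + κ * (1ℚ - 1ℚ)
        ≡⟨ solve 2 (λ a κ → a :+ κ :* (con 1ℚ :- con 1ℚ) := a) refl (δ i j + κ * q) κ ⟩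
      δ i j + κ * q ∎
    -- This value is q times 1 + (n + 1)κ, so positivity passes to the smaller matrix.
    positive′ : 0ℚ < 1ℚ + fromℕ n * (κ * q)
    positive′ = subst (0ℚ <_)
      (begin
        q * (1ℚ + fromℕ (suc n) * κ)
          ≡⟨ solve 3 (λ q m κ → q :* (con 1ℚ :+ (con 1ℚ :+ m) :* κ) := (con 1ℚ :+ κ) :* q :+ m :* (κ :* q)) refl q (fromℕ n) κ ⟩
        (1ℚ + κ) * q + fromℕ n * (κ * q)
          ≡⟨ cong (_+ fromℕ n * (κ * q)) e ⟩
        1ℚ + fromℕ n * (κ * q) ∎)
      (positive⁻¹ _ {{pos*pos⇒pos q {{positive 0<q}} (1ℚ + fromℕ (suc n) * κ) {{positive h}}}})

  module RankOneShift (A : Fin n → Fin n → ℚ) (A-sym : Symmetric A) (κ : ℚ) (0<b : 0ℚ < 1ℚ + fromℕ n * κ) where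

    b D : ℚ
    b = 1ℚ + fromℕ n * κ
    D = detV (tabulate A)

    rowSum : Row n
    rowSum i = sum (A i)

    B : Vec (Row n) n
    B = I+κJ n κ

    shifted : Vec (Row n) n
    shifted = map (combine B) (tabulate A)

    shifted-entry : ∀ a k → combine B a k ≡ a k + κ * sum a
    shifted-entry a k = begin
      sum (λ l → a l * lookup B l k)
        ≡⟨ sum-cong-≗ (λ l → trans (cong (λ z → a l * z k) (lookup∘tabulate (shiftedδ κ) l))
             (solve 3 (λ a d κ → a :* (d :+ κ) := a :* d :+ κ :* a) refl (a l) (δ l k) κ)) ⟩
      sum (λ l → a l * δ l k + κ * a l)
        ≡⟨ sum-linear κ (λ l → a l * δ l k) a ⟩
      sum (λ l → a l * δ l k) + κ * sum a
        ≡⟨ cong (_+ κ * sum a) (sum-δ a k) ⟩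
      a k + κ * sum a ∎

    transposed : Vec (Row n) n
    transposed = tabulate λ k j → lookup shifted j k

    -- By symmetry of A and of `I + κJ`, the transpose of A (I + κJ) is (I + κJ) A, and
    -- multiplicativity gives its determinant.
    detV-transposed : detV transposed ≡ b * D
    detV-transposed = begin
      detV transposed
        ≡⟨ detV-cong (tabulate-≗ λ k j → begin
             lookup shifted j k
               ≡⟨ cong (λ z → z k) (trans (lookup-map j (combine B) (tabulate A)) (cong (combine B) (lookup∘tabulate A j))) ⟩
             sum (λ l → A j l * lookup B l k)
               ≡⟨ sum-cong-≗ (λ l → trans (*-comm (A j l) (lookup B l k)) (cong₂ _*_
                    (trans (cong (λ z → z k) (lookup∘tabulate (shiftedδ κ) l)) (cong (_+ κ) (δ-symmetric l k)))
                    (trans (A-sym j l) (cong (λ z → z j) (sym (lookup∘tabulate A l)))))) ⟩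
             sum (λ l → (shiftedδ κ) k l * lookup (tabulate A) l j) ∎) ⟩
      detV (tabulate (combine (tabulate A) ∘ (shiftedδ κ)))
        ≡⟨ cong detV (tabulate-∘ (combine (tabulate A)) (shiftedδ κ)) ⟩
      detV (map (combine (tabulate A)) B)
        ≡⟨ detV-combine B (tabulate A) ⟩
      detV B * D
        ≡⟨ cong (_* D) (detV-I+κJ n κ 0<b) ⟩
      b * D ∎

    -- The Gram matrix of the rows is the product of `shifted` and its transpose.
    detV-gram-shifted : detV (gram shifted) ≡ (D * b) * (b * D)
    detV-gram-shifted = begin
      detV (gram shifted)
        ≡⟨ detV-cong (map⁺ (λ u j → sum-cong-≗ λ k →
             cong (λ z → u k * z j) (sym (lookup∘tabulate (λ k j → lookup shifted j k) k))) shifted) ⟩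
      detV (map (combine transposed) shifted)
        ≡⟨ detV-combine shifted transposed ⟩
      detV shifted * detV transposed
        ≡⟨ cong₂ _*_ (trans (detV-combine (tabulate A) B) (cong (D *_) (detV-I+κJ n κ 0<b))) detV-transposed ⟩
      (D * b) * (b * D) ∎

    energy-map-tabulate : ∀ {k} (f : Row n → Row n) (R : Fin k → Row n) →
                          energy (map f (tabulate R)) ≡ sum (λ i → dot (f (R i)) (f (R i)))
    energy-map-tabulate {zero}  f R = refl
    energy-map-tabulate {suc k} f R = cong (λ z → dot (f (R zero)) (f (R zero)) + z) (energy-map-tabulate f (R ∘ suc))

    -- Adding κs to all n entries of a row with sum s raises its square sum by 2κs² + nκ²s² = μs².
    -- Moreover nμ = b² - 1.
    μ : ℚ
    μ = κ + κ + fromℕ n * (κ * κ)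

    norm-shifted : ∀ a → dot (combine B a) (combine B a) ≡ dot a a + μ * (sum a * sum a)
    norm-shifted a = begin
      dot (combine B a) (combine B a)
        ≡⟨ sum-cong-≗ (λ k → trans (cong₂ _*_ (shifted-entry a k) (shifted-entry a k))
             (solve 2 (λ a c → (a :+ c) :* (a :+ c) := a :* a :+ ((c :+ c) :* a :+ c :* c)) refl (a k) c)) ⟩
      sum (λ k → a k * a k + ((c + c) * a k + c * c))
        ≡⟨ ∑-distrib-+ (λ k → a k * a k) (λ k → (c + c) * a k + c * c) ⟩
      dot a a + sum (λ k → (c + c) * a k + c * c)
        ≡⟨ cong (λ z → dot a a + z) (trans (∑-distrib-+ (λ k → (c + c) * a k) (λ _ → c * c))
             (cong₂ _+_ (sym (*-distribˡ-sum (c + c) a)) (sum-const n (c * c)))) ⟩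
      dot a a + ((c + c) * sum a + fromℕ n * (c * c))
        ≡⟨ solve 4 (λ e κ s m → e :+ ((κ :* s :+ κ :* s) :* s :+ m :* ((κ :* s) :* (κ :* s)))
             := e :+ (κ :+ κ :+ m :* (κ :* κ)) :* (s :* s)) refl (dot a a) κ (sum a) (fromℕ n) ⟩
      dot a a + μ * (sum a * sum a) ∎
      where c = κ * sum a

    energy-shifted : energy shifted ≡ sum (λ i → dot (A i) (A i)) + μ * dot rowSum rowSum
    energy-shifted = trans (energy-map-tabulate (combine B) A)
      (trans (sum-cong-≗ (λ i → norm-shifted (A i)))
             (sum-linear μ (λ i → dot (A i) (A i)) (λ i → rowSum i * rowSum i)))

    shifted-bound : ∀ u → 0ℚ ≤ u → sum (λ i → dot (A i) (A i)) + μ * dot rowSum rowSum ≤ fromℕ n * u →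
                    (D * b) * (b * D) ≤ u ^ℚ n
    shifted-bound u hu h = subst (_≤ u ^ℚ n) detV-gram-shifted
      (detV-gram-bound shifted u hu (≤-trans (≤-reflexive energy-shifted) h))

  -- The determinant bound for symmetric matrices

  ^-distrib-* : ∀ p q k → (p * q) ^ℚ k ≡ p ^ℚ k * q ^ℚ k
  ^-distrib-* p q zero    = refl
  ^-distrib-* p q (suc k) = trans (cong (p * q *_) (^-distrib-* p q k))
    (solve 4 (λ p q a b → p :* q :* (a :* b) := p :* a :* (q :* b)) refl p q (p ^ℚ k) (q ^ℚ k))

  ∣x∣≤y-from-squares : ∀ {x y} → 0ℚ ≤ y → x * x ≤ y * y → ∣ x ∣ ≤ y
  ∣x∣≤y-from-squares {x} {y} 0≤y h = ≮⇒≥ λ y<∣x∣ →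
    let instance
          _ = positive (≤-<-trans 0≤y y<∣x∣)
          _ = nonNegative 0≤y
    in <-irrefl refl (<-≤-trans
      (≤-<-trans (*-monoˡ-≤-nonNeg y (<⇒≤ y<∣x∣)) (*-monoˡ-<-pos ∣ x ∣ y<∣x∣))
      (≤-trans (≤-reflexive ∣x∣²≡x²) h))
    where
    ∣x∣²≡x² : ∣ x ∣ * ∣ x ∣ ≡ x * x
    ∣x∣²≡x² = trans (sym (∣p*q∣≡∣p∣*∣q∣ x x)) (0≤p⇒∣p∣≡p (0≤square x))

  -- Besides symmetry, only two sums of A enter: those of the squared entries and of the entries.
  -- For a 0/1 matrix they coincide, hence the same value nd for both.
  ryser-type-bound : ∀ k (A : Fin (2 ℕ.+ k) → Fin (2 ℕ.+ k) → ℚ) → Symmetric A →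
    ∀ d a →
    sum (λ i → dot (A i) (A i)) ≡ fromℕ (2 ℕ.+ k) * d → sum (λ i → sum (A i)) ≡ fromℕ (2 ℕ.+ k) * d →
    fromℕ (suc k) * a ≡ fromℕ (2 ℕ.+ k) - d → 1ℚ ≤ d → d ≤ fromℕ (suc k) →
    ∣ detV (tabulate A) ∣ ≤ d ^ℚ (2 ℕ.+ k) * a ^ℚ suc k
  ryser-type-bound k A A-sym d a energy≡ total≡ a-def 1≤d d≤ = *-cancelʳ-≤-pos a ∣D∣a≤
    where
    N N-1 : ℚ
    N   = fromℕ (2 ℕ.+ k)
    N-1 = fromℕ (suc k)

    0≤d : 0ℚ ≤ d
    0≤d = ≤-trans (nonNegative⁻¹ 1ℚ) 1≤d

    0<a : 0ℚ < a
    0<a = *-cancelˡ-<-nonNeg N-1 {{nonNegative (0≤fromℕ (suc k))}} (subst₂ _<_ (sym (*-zeroʳ N-1)) (sym a-def)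
      (<-≤-trans (positive⁻¹ 1ℚ) (≤-from-gap (N-1 - d) (gap d≤) (+-assoc 1ℚ N-1 (- d)))))

    a≤1 : a ≤ 1ℚ
    a≤1 = *-cancelˡ-≤-pos N-1 {{positive (0<fromℕ k)}} (subst (_≤ N-1 * 1ℚ) (sym a-def)
      (≤-from-gap (d - 1ℚ) (gap 1≤d)
        (solve 2 (λ m d → m :* con 1ℚ := (con 1ℚ :+ m :- d) :+ (d :- con 1ℚ)) refl N-1 d)))

    instance
      _ = positive 0<a

    N⁻¹ κ : ℚ
    N⁻¹ = proj₁ (inverse N (0<fromℕ (suc k)))
    κ = N⁻¹ * (a - 1ℚ)

    Nκ≡a-1 : N * κ ≡ a - 1ℚ
    Nκ≡a-1 = begin
      N * (N⁻¹ * (a - 1ℚ)) ≡⟨ sym (*-assoc N N⁻¹ (a - 1ℚ)) ⟩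
      N * N⁻¹ * (a - 1ℚ)   ≡⟨ cong (_* (a - 1ℚ)) (proj₂ (proj₂ (inverse N (0<fromℕ (suc k))))) ⟩
      1ℚ * (a - 1ℚ)        ≡⟨ *-identityˡ (a - 1ℚ) ⟩
      a - 1ℚ ∎

    b≡a : 1ℚ + N * κ ≡ a
    b≡a = trans (cong (λ z → 1ℚ + z) Nκ≡a-1) (solve 1 (λ a → con 1ℚ :+ (a :- con 1ℚ) := a) refl a)

    open RankOneShift A A-sym κ (subst (0ℚ <_) (sym b≡a) 0<a)

    -- Here -μ = (1 - a)(1 + a)/n with 0 < a ≤ 1; hence larger squares of row sums lower the shifted
    -- energy.
    0≤-μ : 0ℚ ≤ - μ
    0≤-μ = subst (0ℚ ≤_) eq
      ((<⇒≤ (proj₁ (proj₂ (inverse N (0<fromℕ (suc k)))))) 0≤* gap a≤1 0≤* (nonNegative⁻¹ 1ℚ 0≤+ <⇒≤ 0<a))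
      where
      eq : N⁻¹ * (1ℚ - a) * (1ℚ + a) ≡ - μ
      eq = begin
        N⁻¹ * (1ℚ - a) * (1ℚ + a)
          ≡⟨ solve 2 (λ i a → i :* (con 1ℚ :- a) :* (con 1ℚ :+ a)
               := :- (i :* (a :- con 1ℚ) :+ i :* (a :- con 1ℚ) :+ (i :* (a :- con 1ℚ)) :* (a :- con 1ℚ))) refl N⁻¹ a ⟩
        - (κ + κ + κ * (a - 1ℚ))
          ≡⟨ cong (λ z → - (κ + κ + κ * z)) (sym Nκ≡a-1) ⟩
        - (κ + κ + κ * (N * κ))
          ≡⟨ solve 2 (λ κ m → :- (κ :+ κ :+ κ :* (m :* κ)) := :- (κ :+ κ :+ m :* (κ :* κ))) refl κ N ⟩
        - μ ∎

    -- n times the variance of the row sums, whose mean is d: the exact surplus of their square sum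
    -- over nd².
    spread : ℚ
    spread = sum (λ i → (rowSum i - d) * (rowSum i - d))

    rowSum²≡ : dot rowSum rowSum ≡ N * (d * d) + spread
    rowSum²≡ = sym (begin
      N * (d * d) + spread
        ≡⟨ cong (λ z → N * (d * d) + z) (begin
             spread
               ≡⟨ sum-cong-≗ (λ i → solve 2 (λ s d → (s :- d) :* (s :- d) := s :* s :+ con (- 1ℚ) :* ((d :+ d) :* s :+ con (- 1ℚ) :* (d :* d))) refl (rowSum i) d) ⟩
             sum (λ i → rowSum i * rowSum i + - 1ℚ * ((d + d) * rowSum i + - 1ℚ * (d * d)))
               ≡⟨ sum-linear (- 1ℚ) (λ i → rowSum i * rowSum i) (λ i → (d + d) * rowSum i + - 1ℚ * (d * d)) ⟩
             dot rowSum rowSum + - 1ℚ * sum (λ i → (d + d) * rowSum i + - 1ℚ * (d * d))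
               ≡⟨ cong (λ z → dot rowSum rowSum + - 1ℚ * z) (trans
                    (sum-linear (- 1ℚ) (λ i → (d + d) * rowSum i) (λ i → d * d))
                    (cong₂ (λ x y → x + - 1ℚ * y)
                      (trans (sym (*-distribˡ-sum (d + d) rowSum)) (cong ((d + d) *_) total≡))
                      (sum-const (2 ℕ.+ k) (d * d)))) ⟩
             dot rowSum rowSum + - 1ℚ * ((d + d) * (N * d) + - 1ℚ * (N * (d * d))) ∎) ⟩
      N * (d * d) + (dot rowSum rowSum + - 1ℚ * ((d + d) * (N * d) + - 1ℚ * (N * (d * d))))
        ≡⟨ solve 3 (λ s d m → m :* (d :* d) :+ (s :+ con (- 1ℚ) :* ((d :+ d) :* (m :* d) :+ con (- 1ℚ) :* (m :* (d :* d)))) := s)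
             refl (dot rowSum rowSum) d N ⟩
      dot rowSum rowSum ∎)

    energy≤ : sum (λ i → dot (A i) (A i)) + μ * dot rowSum rowSum ≤ N * (a * d * (a * d))
    -- The first summand of the gap is the contribution of the variance; the second is (n - 1)ad(ad
    -- - 1), rewritten by `a-def`.
    energy≤ = ≤-from-gap (- μ * spread + a * d * ((d - 1ℚ) * (N-1 - d)))
      (0≤-μ 0≤* 0≤sum _ (λ i → 0≤square (rowSum i - d)) 0≤+ <⇒≤ 0<a 0≤* 0≤d 0≤* (gap 1≤d 0≤* gap d≤))
      (sym (begin
        sum (λ i → dot (A i) (A i)) + μ * dot rowSum rowSum + (- μ * spread + a * d * ((d - 1ℚ) * (N-1 - d)))
          ≡⟨ cong₂ (λ x y → x + μ * y + (- μ * spread + a * d * ((d - 1ℚ) * (N-1 - d)))) energy≡ rowSum²≡ ⟩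
        N * d + μ * (N * (d * d) + spread) + (- μ * spread + a * d * ((d - 1ℚ) * (N-1 - d)))
          -- κ is collected into products Nκ, so that Nκ = a - 1 can be substituted; afterwards N -
          -- d is replaced by (N - 1)a.
          ≡⟨ solve 5 (λ κ d a m v →
               let N = con 1ℚ :+ m ; μ = κ :+ κ :+ N :* (κ :* κ) in
               N :* d :+ μ :* (N :* (d :* d) :+ v) :+ (:- μ :* v :+ a :* d :* ((d :- con 1ℚ) :* (m :- d)))
               := N :* d :+ d :* d :* ((N :* κ) :* (N :* κ :+ (con 1ℚ :+ con 1ℚ))) :+ a :* d :* (d :* (N :- d) :- m))
               refl κ d a N-1 spread ⟩
        N * d + d * d * ((N * κ) * (N * κ + (1ℚ + 1ℚ))) + a * d * (d * (N - d) - N-1)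
          ≡⟨ cong (λ z → N * d + d * d * (z * (z + (1ℚ + 1ℚ))) + a * d * (d * (N - d) - N-1)) Nκ≡a-1 ⟩
        N * d + d * d * ((a - 1ℚ) * (a - 1ℚ + (1ℚ + 1ℚ))) + a * d * (d * (N - d) - N-1)
          ≡⟨ solve 3 (λ d a m → let N = con 1ℚ :+ m in
               N :* d :+ d :* d :* ((a :- con 1ℚ) :* (a :- con 1ℚ :+ (con 1ℚ :+ con 1ℚ))) :+ a :* d :* (d :* (N :- d) :- m)
               := d :* (N :- d) :+ d :* d :* (a :* a) :+ a :* d :* (d :* (N :- d) :- m)) refl d a N-1 ⟩
        d * (N - d) + d * d * (a * a) + a * d * (d * (N - d) - N-1)
          ≡⟨ cong (λ z → d * z + d * d * (a * a) + a * d * (d * z - N-1)) (sym a-def) ⟩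
        d * (N-1 * a) + d * d * (a * a) + a * d * (d * (N-1 * a) - N-1)
          ≡⟨ solve 3 (λ d a m → d :* (m :* a) :+ d :* d :* (a :* a) :+ a :* d :* (d :* (m :* a) :- m)
               := (con 1ℚ :+ m) :* (a :* d :* (a :* d))) refl d a N-1 ⟩
        N * (a * d * (a * d)) ∎))

    [Da]²≤ : (D * a) * (D * a) ≤ ((a * d) ^ℚ (2 ℕ.+ k)) * ((a * d) ^ℚ (2 ℕ.+ k))
    [Da]²≤ = subst₂ _≤_
      (trans (cong (λ z → (D * z) * (z * D)) b≡a) (cong ((D * a) *_) (*-comm a D)))
      (^-distrib-* (a * d) (a * d) (2 ℕ.+ k))
      (shifted-bound (a * d * (a * d)) (0≤square (a * d)) energy≤)

    -- The right side carries n factors a and the left side one; cancelling it leaves the exponent n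
    -- - 1.
    ∣D∣a≤ : ∣ D ∣ * a ≤ d ^ℚ (2 ℕ.+ k) * a ^ℚ suc k * a
    ∣D∣a≤ = subst₂ _≤_
      (trans (∣p*q∣≡∣p∣*∣q∣ D a) (cong (∣ D ∣ *_) (0≤p⇒∣p∣≡p (<⇒≤ 0<a))))
      (trans (^-distrib-* a d (2 ℕ.+ k))
        (solve 3 (λ a x y → a :* x :* y := y :* x :* a) refl a (a ^ℚ suc k) (d ^ℚ (2 ℕ.+ k))))
      (∣x∣≤y-from-squares (0≤^ (2 ℕ.+ k) (<⇒≤ 0<a 0≤* 0≤d)) [Da]²≤)

  -- Integers, counting and graphs

  ι : ℤ → ℚ
  ι z = z / 1

  -- `z / 1` is normalised, so the two sides are compared as unnormalised rationals, by
  -- cross-multiplication.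
  ι-+ : ∀ a b → ι (a ℤ.+ b) ≡ ι a + ι b
  ι-+ a b = trans (fromℚᵘ-cong {mkℚᵘ (a ℤ.+ b) 0} {toℚᵘ (ι a + ι b)}
    (ℚᵘ.≃-trans {mkℚᵘ (a ℤ.+ b) 0} {mkℚᵘ a 0 ℚᵘ.+ mkℚᵘ b 0} {toℚᵘ (ι a + ι b)}
      (*≡* (cong (ℤ._* + 1) (sym (cong₂ ℤ._+_ (ℤ.*-identityʳ a) (ℤ.*-identityʳ b)))))
      (ℚᵘ.≃-sym (ℚᵘ.≃-trans (toℚᵘ-homo-+ (ι a) (ι b))
        (ℚᵘ.+-cong (toℚᵘ-fromℚᵘ (mkℚᵘ a 0)) (toℚᵘ-fromℚᵘ (mkℚᵘ b 0)))))))
    (fromℚᵘ-toℚᵘ (ι a + ι b))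

  toℚᵘ-*ι : ∀ p d a → toℚᵘ (fromℚᵘ (mkℚᵘ p d) * ι a) ℚᵘ.≃ mkℚᵘ p d ℚᵘ.* mkℚᵘ a 0
  toℚᵘ-*ι p d a = ℚᵘ.≃-trans (toℚᵘ-homo-* (fromℚᵘ (mkℚᵘ p d)) (ι a))
    (ℚᵘ.*-cong (toℚᵘ-fromℚᵘ (mkℚᵘ p d)) (toℚᵘ-fromℚᵘ (mkℚᵘ a 0)))

  ι-* : ∀ a b → ι (a ℤ.* b) ≡ ι a * ι b
  ι-* a b = trans (sym (fromℚᵘ-cong (toℚᵘ-*ι a 0 b))) (fromℚᵘ-toℚᵘ (ι a * ι b))

  /-*-cancel : ∀ p d → (p / suc d) * ι (+ suc d) ≡ ι p
  /-*-cancel p d = begin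
    (p / suc d) * ι (+ suc d)
      ≡⟨ sym (fromℚᵘ-toℚᵘ ((p / suc d) * ι (+ suc d))) ⟩
    fromℚᵘ (toℚᵘ ((p / suc d) * ι (+ suc d)))
      ≡⟨ fromℚᵘ-cong {y = mkℚᵘ p 0} (ℚᵘ.≃-trans (toℚᵘ-*ι p d (+ suc d)) (*≡* (ℤ.*-assoc p (+ suc d) (+ 1)))) ⟩
    ι p ∎

  ι-cancel-< : ∀ {a b} → ι a < ι b → a ℤ.< b
  ι-cancel-< {a} {b} h = subst₂ ℤ._<_ (ℤ.*-identityʳ a) (ℤ.*-identityʳ b) (ℚᵘ.drop-*<*
    (ℚᵘ.<-respˡ-≃ (toℚᵘ-fromℚᵘ (mkℚᵘ a 0)) (ℚᵘ.<-respʳ-≃ (toℚᵘ-fromℚᵘ (mkℚᵘ b 0)) (toℚᵘ-mono-< h))))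

  ι-neg : ∀ a → ι (ℤ.- a) ≡ - ι a
  ι-neg a = begin
    ι (ℤ.- a)               ≡⟨ cong ι (sym (ℤ.-1*i≡-i a)) ⟩
    ι (ℤ.-1ℤ ℤ.* a)     ≡⟨ ι-* ℤ.-1ℤ a ⟩
    - 1ℚ * ι a              ≡⟨ solve 1 (λ a → con (- 1ℚ) :* a := :- a) refl (ι a) ⟩
    - ι a ∎

  ι-fromℕ : ∀ n → ι (+ n) ≡ fromℕ n
  ι-fromℕ zero    = refl
  ι-fromℕ (suc n) = trans (ι-+ (+ 1) (+ n)) (cong (λ z → 1ℚ + z) (ι-fromℕ n))

  ι-sumFinℤ : ∀ n (f : Fin n → ℤ) → ι (sumFinℤ n f) ≡ sum (λ i → ι (f i))
  ι-sumFinℤ zero    f = refl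
  ι-sumFinℤ (suc n) f = trans (ι-+ (f zero) _) (cong (λ z → ι (f zero) + z) (ι-sumFinℤ n (f ∘ suc)))

  ι-sumFinℕ : ∀ n (f : Fin n → ℕ) → ι (+ sumFinℕ n f) ≡ sum (λ i → ι (+ f i))
  ι-sumFinℕ zero    f = refl
  ι-sumFinℕ (suc n) f = trans (ι-+ (+ f zero) (+ sumFinℕ n (f ∘ suc))) (cong (λ z → ι (+ f zero) + z) (ι-sumFinℕ n (f ∘ suc)))

  ι-sign : (j : Fin n) → ι (ℤ.-1ℤ ℤ.^ toℕ j) ≡ sign j
  ι-sign zero    = refl
  ι-sign (suc j) = begin
    ι (ℤ.-1ℤ ℤ.* ℤ.-1ℤ ℤ.^ toℕ j) ≡⟨ cong ι (ℤ.-1*i≡-i (ℤ.-1ℤ ℤ.^ toℕ j)) ⟩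
    ι (ℤ.- (ℤ.-1ℤ ℤ.^ toℕ j))         ≡⟨ ι-neg (ℤ.-1ℤ ℤ.^ toℕ j) ⟩
    - ι (ℤ.-1ℤ ℤ.^ toℕ j)             ≡⟨ cong -_ (ι-sign j) ⟩
    - sign j ∎

  ι-det : ∀ n (A : Fin n → Fin n → ℤ) → ι (det n A) ≡ detV (tabulate λ i j → ι (A i j))
  ι-det zero    A = refl
  ι-det (suc n) A = trans (ι-sumFinℤ (suc n) (λ j → s j ℤ.* A zero j ℤ.* d j)) (sum-cong-≗ λ j → begin
    ι (s j ℤ.* A zero j ℤ.* d j)
      ≡⟨ trans (ι-* (s j ℤ.* A zero j) (d j)) (cong (_* ι (d j)) (ι-* (s j) (A zero j))) ⟩
    ι (s j) * ι (A zero j) * ι (d j)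
      ≡⟨ cong₂ (λ x y → x * ι (A zero j) * y) (ι-sign j) (ι-det n (λ i k → A (suc i) (punchIn j k))) ⟩
    sign j * ι (A zero j) * detV (tabulate λ i k → ι (A (suc i) (punchIn j k)))
      ≡⟨ cong (λ R → sign j * ι (A zero j) * detV R) (tabulate-∘ (_∘ punchIn j) (λ i k → ι (A (suc i) k))) ⟩
    sign j * ι (A zero j) * detV (map (_∘ punchIn j) (tabulate λ i k → ι (A (suc i) k))) ∎)
    where
    s d : Fin (suc n) → ℤ
    s j = ℤ.-1ℤ ℤ.^ toℕ j
    d j = det n (λ i k → A (suc i) (punchIn j k))

  ι²<1⇒≡0 : ∀ z → ι z * ι z < 1ℚ → z ≡ + 0
  ι²<1⇒≡0 z h = go z (ι-cancel-< (subst (_< 1ℚ) (sym (ι-* z z)) h))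
    where
    go : ∀ z → z ℤ.* z ℤ.< + 1 → z ≡ + 0
    go +0       _                  = refl
    go +[1+ n ] (ℤ.+<+ (ℕ.s≤s ()))
    go -[1+ n ] (ℤ.+<+ (ℕ.s≤s ()))

  /ℕ-cancel : ∀ p d → (p /ℕ suc d) * fromℕ (suc d) ≡ ι p
  /ℕ-cancel p d = trans (cong ((p / suc d) *_) (sym (ι-fromℕ (suc d)))) (/-*-cancel p d)

  fromℕ-* : ∀ m n → fromℕ (m ℕ.* n) ≡ fromℕ m * fromℕ n
  fromℕ-* m n = begin
    fromℕ (m ℕ.* n)     ≡⟨ sym (ι-fromℕ (m ℕ.* n)) ⟩
    ι (+ (m ℕ.* n))     ≡⟨ cong ι (ℤ.pos-* m n) ⟩
    ι (+ m ℤ.* + n)     ≡⟨ ι-* (+ m) (+ n) ⟩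
    ι (+ m) * ι (+ n)   ≡⟨ cong₂ _*_ (ι-fromℕ m) (ι-fromℕ n) ⟩
    fromℕ m * fromℕ n ∎

  sum-mono-≤ : ∀ {f g : Row n} → (∀ i → f i ≤ g i) → sum f ≤ sum g
  sum-mono-≤ {zero}  h = ≤-refl
  sum-mono-≤ {suc n} h = +-mono-≤ (h zero) (sum-mono-≤ (h ∘ suc))

  -- Adjacency matrices of graphs

  indicator : Bool → ℚ
  indicator b = if b then 1ℚ else 0ℚ

  0≤indicator : ∀ b → 0ℚ ≤ indicator b
  0≤indicator true  = nonNegative⁻¹ 1ℚ
  0≤indicator false = ≤-refl

  indicator≤1 : ∀ b → indicator b ≤ 1ℚ
  indicator≤1 true  = ≤-refl
  indicator≤1 false = nonNegative⁻¹ 1ℚ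

  module Adjacency (G : SimpleGraph n) where

    A : Fin n → Fin n → ℚ
    A i j = indicator (adj G i j)

    A-symmetric : Symmetric A
    A-symmetric i j = cong indicator (symmetric G i j)

    ι-detG : ι (detG G) ≡ detV (tabulate A)
    ι-detG = trans (ι-det n (adjMatrix G)) (detV-cong (tabulate-≗ λ i j → entry (adj G i j)))
      where
      entry : ∀ b → ι (if b then + 1 else + 0) ≡ indicator b
      entry true  = refl
      entry false = refl

    ascending : Fin n → Fin n → ℚ
    ascending i j = indicator (adj G i j ∧ ⌊ toℕ i ℕ.<? toℕ j ⌋)

    -- An adjacent pair is ascending in exactly one of its two orders; a tie would be a loop.
    A-split : ∀ i j → A i j ≡ ascending i j + ascending j i
    A-split i j rewrite symmetric G j i with adj G i j in e | toℕ i ℕ.<? toℕ j | toℕ j ℕ.<? toℕ i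
    ... | false | _       | _       = refl
    ... | true  | yes i<j | yes j<i = ⊥-elim (ℕ.<-asym i<j j<i)
    ... | true  | yes i<j | no  _   = refl
    ... | true  | no  _   | yes j<i = refl
    ... | true  | no  i≮j | no  j≮i
      with refl ← toℕ-injective {i = i} {j} (ℕ.≤-antisym (ℕ.≮⇒≥ j≮i) (ℕ.≮⇒≥ i≮j))
      with () ← trans (sym e) (loopless G i)

    ι-edgeCount : ι (+ edgeCount G) ≡ sum (λ i → sum (ascending i))
    ι-edgeCount = trans (ι-sumFinℕ n _) (sum-cong-≗ λ i → trans (ι-sumFinℕ n _) (sum-cong-≗ λ j →
      entry (adj G i j ∧ ⌊ toℕ i ℕ.<? toℕ j ⌋)))
      where
      entry : ∀ b → ι (+ (if b then 1 else 0)) ≡ indicator b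
      entry true  = refl
      entry false = refl

    handshake : sum (λ i → sum (A i)) ≡ ι (+ (2 ℕ.* edgeCount G))
    handshake = begin
      sum (λ i → sum (A i))
        ≡⟨ sum-cong-≗ (λ i → trans (sum-cong-≗ (A-split i)) (∑-distrib-+ (ascending i) (λ j → ascending j i))) ⟩
      sum (λ i → sum (ascending i) + sum (λ j → ascending j i))
        ≡⟨ ∑-distrib-+ (λ i → sum (ascending i)) (λ i → sum (λ j → ascending j i)) ⟩
      sum (λ i → sum (ascending i)) + sum (λ i → sum (λ j → ascending j i))
        ≡⟨ cong (λ z → sum (λ i → sum (ascending i)) + z) (∑-comm (λ i j → ascending j i)) ⟩
      sum (λ i → sum (ascending i)) + sum (λ i → sum (ascending i))
        ≡⟨ sym (cong₂ _+_ ι-edgeCount ι-edgeCount) ⟩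
      ι (+ e) + ι (+ e)
        ≡⟨ sym (ι-+ (+ e) (+ e)) ⟩
      ι (+ (e ℕ.+ e))
        ≡⟨ cong (λ x → ι (+ (e ℕ.+ x))) (sym (ℕ.+-identityʳ e)) ⟩
      ι (+ (2 ℕ.* e)) ∎
      where e = edgeCount G

    energy≡total : sum (λ i → dot (A i) (A i)) ≡ sum (λ i → sum (A i))
    energy≡total = sum-cong-≗ λ i → sum-cong-≗ λ j → idempotent (adj G i j)
      where
      idempotent : ∀ b → indicator b * indicator b ≡ indicator b
      idempotent true  = refl
      idempotent false = refl

  -- Supplies d ≤ n - 1, which makes a positive and the factor n - 1 - d of the energy gap
  -- nonnegative.
  total≤ : (G : SimpleGraph (suc n)) → let open Adjacency G in
           sum (λ i → sum (A i)) ≤ fromℕ (suc n) * fromℕ n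
  total≤ {n} G = ≤-trans (sum-mono-≤ degree≤) (≤-reflexive (sum-const (suc n) (fromℕ n)))
    where
    open Adjacency G
    degree≤ : ∀ i → sum (A i) ≤ fromℕ n
    degree≤ i = ≤-trans
      (≤-reflexive (begin
        sum (A i)                        ≡⟨ sum-remove {i = i} (A i) ⟩
        A i i + sum (A i ∘ punchIn i)    ≡⟨ cong (λ b → indicator b + sum (A i ∘ punchIn i)) (loopless G i) ⟩
        0ℚ + sum (A i ∘ punchIn i)       ≡⟨ +-identityˡ (sum (A i ∘ punchIn i)) ⟩
        sum (A i ∘ punchIn i) ∎))
      (≤-trans (sum-mono-≤ (λ j → indicator≤1 (adj G i (punchIn i j))))
        (≤-reflexive (trans (sum-const n 1ℚ) (*-identityʳ (fromℕ n)))))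

  -- The shift with κ = 0, where b = 1 and μ = 0, is Hadamard's inequality for A itself.
  d<1⇒det≡0 : (G : SimpleGraph (suc n)) → let open Adjacency G in ∀ d → 0ℚ ≤ d → d < 1ℚ →
              sum (λ i → sum (A i)) ≡ fromℕ (suc n) * d → detG G ≡ + 0
  d<1⇒det≡0 {n} G d 0≤d d<1 total≡ = ι²<1⇒≡0 (detG G) (subst (λ z → z * z < 1ℚ) (sym ι-detG)
    (≤-<-trans (≤-trans (≤-reflexive D²) (shifted-bound d 0≤d energy≤)) (d^<1 n)))
    where
    open Adjacency G
    instance
      _ = nonNegative 0≤d
    b≡1 : 1ℚ + fromℕ (suc n) * 0ℚ ≡ 1ℚ
    b≡1 = solve 1 (λ m → con 1ℚ :+ m :* con 0ℚ := con 1ℚ) refl (fromℕ (suc n))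
    open RankOneShift A A-symmetric 0ℚ (subst (0ℚ <_) (sym b≡1) (positive⁻¹ 1ℚ)) hiding (b)
    D² : D * D ≡ (D * (1ℚ + fromℕ (suc n) * 0ℚ)) * ((1ℚ + fromℕ (suc n) * 0ℚ) * D)
    D² = solve 2 (λ D m → D :* D := (D :* (con 1ℚ :+ m :* con 0ℚ)) :* ((con 1ℚ :+ m :* con 0ℚ) :* D)) refl D (fromℕ (suc n))
    energy≤ : sum (λ i → dot (A i) (A i)) + μ * dot rowSum rowSum ≤ fromℕ (suc n) * d
    energy≤ = ≤-reflexive (trans (cong (_+ μ * dot rowSum rowSum) (trans energy≡total total≡))
      (solve 3 (λ m d s → m :* d :+ (con 0ℚ :+ con 0ℚ :+ m :* (con 0ℚ :* con 0ℚ)) :* s := m :* d) refl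
        (fromℕ (suc n)) d (dot rowSum rowSum)))
    d^<1 : ∀ k → d ^ℚ suc k < 1ℚ
    d^<1 zero    = subst (_< 1ℚ) (sym (*-identityʳ d)) d<1
    d^<1 (suc k) = ≤-<-trans (≤-trans (*-monoˡ-≤-nonNeg d (<⇒≤ (d^<1 k))) (≤-reflexive (*-identityʳ d))) d<1

  det-bound : ∀ k (G : SimpleGraph (2 ℕ.+ k)) →
    ∣ ι (detG G) ∣ ≤
      ((+ (2 ℕ.* edgeCount G) /ℕ (2 ℕ.+ k)) ^ℚ (2 ℕ.+ k))
        * ((1ℚ - ((+ (2 ℕ.* edgeCount G) ℤ.- + (2 ℕ.+ k)) /ℕ ((2 ℕ.+ k) ℕ.* suc k))) ^ℚ suc k)
  det-bound k G = bound (d <? 1ℚ)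
    where
    open Adjacency G
    t d e a N N-1 : ℚ
    t   = ι (+ (2 ℕ.* edgeCount G))
    d   = + (2 ℕ.* edgeCount G) /ℕ (2 ℕ.+ k)
    e   = (+ (2 ℕ.* edgeCount G) ℤ.- + (2 ℕ.+ k)) /ℕ ((2 ℕ.+ k) ℕ.* suc k)
    a   = 1ℚ - e
    N   = fromℕ (2 ℕ.+ k)
    N-1 = fromℕ (suc k)

    instance
      _ = positive (0<fromℕ k)
      _ = positive (0<fromℕ (suc k))

    dN≡t : d * N ≡ t
    dN≡t = /ℕ-cancel (+ (2 ℕ.* edgeCount G)) (suc k)

    total≡ : sum (λ i → sum (A i)) ≡ N * d
    total≡ = trans handshake (trans (sym dN≡t) (*-comm d N))

    0≤d : 0ℚ ≤ d
    0≤d = *-cancelˡ-≤-pos N (subst₂ _≤_ (sym (*-zeroʳ N)) total≡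
      (0≤sum _ λ i → 0≤sum _ λ j → 0≤indicator (adj G i j)))

    d≤N-1 : d ≤ N-1
    d≤N-1 = *-cancelˡ-≤-pos N (subst (_≤ N * N-1) total≡ (total≤ G))

    eNN-1≡ : e * (N * N-1) ≡ d * N - N
    eNN-1≡ = begin
      e * (N * N-1)                             ≡⟨ cong (e *_) (sym (fromℕ-* (2 ℕ.+ k) (suc k))) ⟩
      e * fromℕ ((2 ℕ.+ k) ℕ.* suc k)           ≡⟨ /ℕ-cancel (+ (2 ℕ.* edgeCount G) ℤ.- + (2 ℕ.+ k)) _ ⟩
      ι (+ (2 ℕ.* edgeCount G) ℤ.- + (2 ℕ.+ k)) ≡⟨ ι-+ (+ (2 ℕ.* edgeCount G)) (ℤ.- (+ (2 ℕ.+ k))) ⟩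
      t + ι (ℤ.- (+ (2 ℕ.+ k)))                 ≡⟨ cong₂ _+_ (sym dN≡t) (trans (ι-neg (+ (2 ℕ.+ k))) (cong -_ (ι-fromℕ (2 ℕ.+ k)))) ⟩
      d * N - N ∎

    -- Identifies 1 - (2m - n)/(n(n - 1)) with (n - d)/(n - 1): both denominators are cleared, then
    -- the common factor N is cancelled.
    a-def : N-1 * a ≡ N - d
    a-def = *-cancel-pos (begin
      N * (N-1 * (1ℚ - e))    ≡⟨ solve 3 (λ m n e → n :* (m :* (con 1ℚ :- e)) := n :* m :- e :* (n :* m)) refl N-1 N e ⟩
      N * N-1 - e * (N * N-1) ≡⟨ cong (λ z → N * N-1 - z) eNN-1≡ ⟩
      N * N-1 - (d * N - N)   ≡⟨ solve 2 (λ m d → let n = con 1ℚ :+ m in n :* m :- (d :* n :- n) := n :* (n :- d)) refl N-1 d ⟩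
      N * (N - d) ∎)
      where
      *-cancel-pos : ∀ {p q} → N * p ≡ N * q → p ≡ q
      *-cancel-pos h = ≤-antisym (*-cancelˡ-≤-pos N (≤-reflexive h)) (*-cancelˡ-≤-pos N (≤-reflexive (sym h)))

    0≤a : 0ℚ ≤ a
    0≤a = *-cancelˡ-≤-pos N-1 (subst₂ _≤_ (sym (*-zeroʳ N-1)) (sym a-def)
      (gap (≤-trans d≤N-1 (≤-from-gap 1ℚ (nonNegative⁻¹ 1ℚ) (+-comm 1ℚ N-1)))))

    bound : Dec (d < 1ℚ) → ∣ ι (detG G) ∣ ≤ d ^ℚ (2 ℕ.+ k) * a ^ℚ suc k
    -- With determinant 0 the claim reduces to nonnegativity of the right side, hence the need for 0
    -- ≤ a.
    bound (yes d<1) = subst (λ z → ∣ ι z ∣ ≤ d ^ℚ (2 ℕ.+ k) * a ^ℚ suc k)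
      (sym (d<1⇒det≡0 G d 0≤d d<1 total≡)) (0≤^ (2 ℕ.+ k) 0≤d 0≤* 0≤^ (suc k) 0≤a)
    bound (no  d≮1) = subst (λ z → ∣ z ∣ ≤ d ^ℚ (2 ℕ.+ k) * a ^ℚ suc k) (sym ι-detG)
      (ryser-type-bound k A A-symmetric d a (trans energy≡total total≡) total≡ a-def (≮⇒≥ d≮1) d≤N-1)

open import Data.Nat using (ℕ; _*_; _∸_)
open import Data.Integer using (+_)
open import Data.Integer as ℤ using ()
open import Data.Rational as ℚ using ()

theorem2p5 : (n : ℕ) → 2 Data.Nat.≤ n → (G : SimpleGraph n) →
    ℚ.∣ detG G ℚ./ 1 ∣ ℚ.≤
    ((+ (2 * edgeCount G) /ℕ n) ^ℚ n)
    ℚ.* ((ℚ.1ℚ ℚ.- ((+ (2 * edgeCount G) ℤ.- + n) /ℕ (n * (n ∸ 1)))) ^ℚ (n ∸ 1))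
theorem2p5 (Data.Nat.suc (Data.Nat.suc k)) (Data.Nat.s≤s (Data.Nat.s≤s _)) G = DeterminantBound.det-bound k G
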